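{- Fix $d\in\mathbb N=\{1,2,\ldots\}$. Then for every modular ortholattice $L$ of height $d$ admitting an orthogonal $d$-diamond and for every ortholattice term $t(\bar x)$ (with $\bar y=(y_0,\ldots,y_d)$ new variables): (a) $t(\bar x)$ is weakly satisfiable in $L$ if and only if $\tilde h_d\big(t(\bar x),\bar y\big)$ is strongly satisfiable in $L$. (b) $t(\bar x)$ is strongly satisfiable in $L$ if and only if $\tilde g_d\big(t(\bar x),\bar y\big)$ is weakly satisfiable in $L$. In particular, for every $*$-subfield $\mathbb F$ of $\mathbb C$ and every finite-dimensional $\mathbb F$-unitary space $\mathcal H$, the problems $\mathrm{sat}_{\mathrm L(\mathcal H)}$ and $\mathrm{SAT}_{\mathrm L(\mathcal H)}$ are mutually polynomial-time many-one reducible: $\mathrm{sat}_{\mathrm L(\mathcal H)}\preceq\mathrm{SAT}_{\mathrm L(\mathcal H)}\preceq\mathrm{sat}_{\mathrm L(\mathcal H)}$.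
   Context: A modular ortholattice (MOL) is a modular lattice $L$ with $0,1$ and an order-reversing involution $\neg$ with $a\wedge\neg a=0$, $a\vee\neg a=1$. Its height (dimension) is the cardinality of a maximal chain minus one. An orthogonal $d$-diamond in $L$ is a system $(a_0,a_1,\ldots,a_d)$ of elements with $a_1\vee\cdots\vee a_d=1$; $a_i\le\neg a_j$ for $1\le i\ne j\le d$; and $a_0\wedge a_i=0$, $a_0\vee a_i=1$ for $1\le i\le d$. An ortholattice term is built from variables with $\wedge,\vee,\neg,0,1$; $t_L(\bar a)$ is its value. $t$ is strongly (weakly) satisfiable in $L$ if $t_L(\bar a)=1$ (resp. $t_L(\bar a)\neq0$) for some $\bar a$. $\mathrm{SAT}_L$, $\mathrm{sat}_L\subseteq\{0,1\}^*$ are the sets of (encodings of) strongly, resp. weakly, satisfiable terms. With $\bar y=(y_0,\ldots,y_d)$ define $h_d(\bar y)=\Big(\bigvee_{i=1}^d\big(y_i\wedge\bigwedge_{0<j\ne i}\neg y_j\big)\Big)\wedge\bigwedge_{i=1}^d\big((y_0\vee y_i)\wedge(\neg y_0\vee\neg y_i)\big)$, $\hat h_d(x,\bar y)=\bigvee_{i,j=1}^d\Big(\big(((x\vee\neg y_i)\wedge y_i)\vee y_0\big)\wedge y_j\Big)$, $\tilde h_d(x,\bar y)=h_d(\bar y)\wedge\hat h_d(x,\bar y)$, $g_d(\bar y)=\neg y_0\wedge\bigwedge_{i=1}^d\big(y_0\vee(y_i\wedge\bigwedge_{0<j\neq i}\neg y_j)\big)$, $\tilde g_d(x,\bar y)=g_d(\bar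 y)\wedge\bigwedge_{i=1}^d\big(y_0\vee(x\wedge y_i)\big)$. A $*$-subfield of $\mathbb C$ is a subfield closed under complex conjugation. An $\mathbb F$-unitary space is an $\mathbb F$-vector space with a map $\langle\cdot\mid\cdot\rangle$ into $\mathbb F$, linear in the right argument, with $\langle y\mid x\rangle=\overline{\langle x\mid y\rangle}$ and $\langle x\mid x\rangle\ne0$ for $x\neq0$. $\mathrm L(\mathcal H)$ is the ortholattice of linear subspaces of finite-dimensional $\mathcal H$ under $\cap$, $+$, $^\perp$, $\{\vec 0\}$, $\mathcal H$. -}

module Defs where

open import Algebra.Bundles using (CommutativeMonoid; CommutativeRing; RawRing)
open import Algebra.Core using (Op₁; Op₂)
open import Algebra.Module.Bundles using (LeftModule)
open import Algebra.Morphism.Structures using (IsRingMonomorphism)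
import Algebra.Morphism.RingMonomorphism as RingMonomorphism
import Algebra.Properties.CommutativeMonoid.Sum as Sum
import Algebra.Properties.CommutativeSemigroup as CommutativeSemigroupProperties
import Algebra.Properties.Ring
import Algebra.Solver.Ring.NaturalCoefficients.Default as SemiringSolver
open import Data.Bool.Base using (Bool; true; false)
open import Data.Fin.Base as Fin using (Fin; zero; suc)
import Data.Fin.Properties as Fin
open import Data.List.Base as List using (List; []; _∷_; _++_; allFin; filter; length)
open import Data.Maybe.Base as Maybe using (Maybe; nothing; maybe′)
open import Data.Nat.Base as ℕ using (ℕ; zero; suc)
open import Data.Nat.Binary.Base using (ℕᵇ; zero; 2[1+_]; 1+[2_]; fromℕ)
import Data.Nat.Properties as ℕ
open import Data.Product.Base using (∃; ∃-syntax; _×_; _,_; proj₁; proj₂)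
open import Data.Rational.Base as ℚ using (ℚ; 0ℚ; 1ℚ; ½)
import Data.Rational.Properties as ℚ
open import Data.Sum.Base using (_⊎_)
open import Data.Unit.Polymorphic.Base using (⊤)
open import Data.Vec.Base as Vec using (Vec; _[_]≔_)
import Data.Vec.Functional as Vector
open import Function.Bundles using (_⇔_; _↔_)
open import Level using (_⊔_; Lift; lift; lower; 0ℓ) renaming (suc to lsuc)
open import Relation.Binary.Core using (Rel)
open import Relation.Binary.Lattice.Bundles using (BoundedLattice)
open import Relation.Binary.Structures using (IsEquivalence)
open import Relation.Binary.PropositionalEquality as ≡ using (_≡_)
open import Relation.Nullary.Decidable using (¬?)
open import Relation.Nullary.Negation using (¬_)
open import Relation.Unary using (Pred; _∈_; _⊆_)

record RawOrtholattice c ℓ : Set (lsuc (c ⊔ ℓ)) where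
  infix 4 _≈_
  infixr 6 _∨_
  infixr 7 _∧_
  infix 8 ∼_
  field
    Carrier : Set c
    _≈_     : Rel Carrier ℓ
    _∧_ _∨_ : Op₂ Carrier
    ∼_      : Op₁ Carrier
    0# 1#   : Carrier

record ModularOrtholattice c ℓ₁ ℓ₂ : Set (lsuc (c ⊔ ℓ₁ ⊔ ℓ₂)) where
  infix 8 ∼_
  field
    boundedLattice : BoundedLattice c ℓ₁ ℓ₂

  open BoundedLattice boundedLattice public
    renaming (⊥ to 0#; ⊤ to 1#)

  field
    modular      : ∀ x y z → x ≤ z → x ∨ (y ∧ z) ≈ (x ∨ y) ∧ z
    ∼_           : Op₁ Carrier
    ∼-antitone   : ∀ {x y} → x ≤ y → ∼ y ≤ ∼ x
    ∼-involutive : ∀ x → ∼ ∼ x ≈ x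
    ∧-complement : ∀ x → x ∧ ∼ x ≈ 0#
    ∨-complement : ∀ x → x ∨ ∼ x ≈ 1#

  rawOrtholattice : RawOrtholattice c ℓ₁
  rawOrtholattice = record
    { _≈_ = _≈_ ; _∧_ = _∧_ ; _∨_ = _∨_ ; ∼_ = ∼_ ; 0# = 0# ; 1# = 1# }

module _ {c ℓ₁ ℓ₂} (L : ModularOrtholattice c ℓ₁ ℓ₂) where
  open ModularOrtholattice L

  record IsMaximalChain {d} (chain : Fin (suc d) → Carrier) : Set (c ⊔ ℓ₁ ⊔ ℓ₂) where
    field
      strict  : ∀ i j → i Fin.< j → chain i ≤ chain j × ¬ chain i ≈ chain j
      maximal : ∀ x → (∀ i → x ≤ chain i ⊎ chain i ≤ x) → ∃[ i ] x ≈ chain i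

  HasHeight : ℕ → Set (c ⊔ ℓ₁ ⊔ ℓ₂)
  HasHeight d = ∃[ chain ] IsMaximalChain {d} chain

  record IsOrthogonalDiamond (d : ℕ) (a : Fin (suc d) → Carrier) : Set (c ⊔ ℓ₁ ⊔ ℓ₂) where
    field
      join       : Vector.foldr _∨_ 0# (λ i → a (suc i)) ≈ 1#
      orthogonal : ∀ (i j : Fin d) → ¬ i ≡ j → a (suc i) ≤ ∼ a (suc j)
      meet₀      : ∀ (i : Fin d) → a zero ∧ a (suc i) ≈ 0#
      join₀      : ∀ (i : Fin d) → a zero ∨ a (suc i) ≈ 1#

  AdmitsOrthogonalDiamond : ℕ → Set (c ⊔ ℓ₁ ⊔ ℓ₂)
  AdmitsOrthogonalDiamond d = ∃[ a ] IsOrthogonalDiamond d a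

infixr 6 _∨ₜ_
infixr 7 _∧ₜ_
infix 8 ¬ₜ_

data Term {v} (V : Set v) : Set v where
  var       : V → Term V
  _∧ₜ_ _∨ₜ_ : Term V → Term V → Term V
  ¬ₜ_       : Term V → Term V
  0ₜ 1ₜ     : Term V

rename : ∀ {v w} {V : Set v} {W : Set w} → (V → W) → Term V → Term W
rename f (var x)  = var (f x)
rename f (s ∧ₜ t) = rename f s ∧ₜ rename f t
rename f (s ∨ₜ t) = rename f s ∨ₜ rename f t
rename f (¬ₜ t)   = ¬ₜ rename f t
rename f 0ₜ       = 0ₜ
rename f 1ₜ       = 1ₜ

module _ {c ℓ} (L : RawOrtholattice c ℓ) {v} {V : Set v} where
  open RawOrtholattice L

  eval : (V → Carrier) → Term V → Carrier
  eval ρ (var x)  = ρ x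
  eval ρ (s ∧ₜ t) = eval ρ s ∧ eval ρ t
  eval ρ (s ∨ₜ t) = eval ρ s ∨ eval ρ t
  eval ρ (¬ₜ t)   = ∼ eval ρ t
  eval ρ 0ₜ       = 0#
  eval ρ 1ₜ       = 1#

  StronglySatisfiable WeaklySatisfiable : Term V → Set (c ⊔ ℓ ⊔ v)
  StronglySatisfiable t = ∃[ ρ ] eval ρ t ≈ 1#
  WeaklySatisfiable   t = ∃[ ρ ] ¬ eval ρ t ≈ 0#

module _ {v} {V : Set v} {d : ℕ} where

  ⋁ ⋀ : List (Fin d) → (Fin d → Term V) → Term V
  ⋁ is t = List.foldr _∨ₜ_ 0ₜ (List.map t is)
  ⋀ is t = List.foldr _∧ₜ_ 1ₜ (List.map t is)

  _≠-indices : Fin d → List (Fin d)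
  i ≠-indices = filter (λ j → ¬? (j Fin.≟ i)) (allFin d)

  -- y zero is y₀; for i : Fin d, y (suc i) runs through y₁, …, y_d.
  isolated : (Fin (suc d) → Term V) → Fin d → Term V
  isolated y i = y (suc i) ∧ₜ ⋀ (i ≠-indices) (λ j → ¬ₜ y (suc j))

  h : (Fin (suc d) → Term V) → Term V
  h y = ⋁ (allFin d) (isolated y)
      ∧ₜ ⋀ (allFin d) (λ i → (y zero ∨ₜ y (suc i)) ∧ₜ (¬ₜ y zero ∨ₜ ¬ₜ y (suc i)))

  h-hat : Term V → (Fin (suc d) → Term V) → Term V
  h-hat x y = ⋁ (allFin d) λ i → ⋁ (allFin d) λ j →
    (((x ∨ₜ ¬ₜ y (suc i)) ∧ₜ y (suc i)) ∨ₜ y zero) ∧ₜ y (suc j)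

  h-tilde : Term V → (Fin (suc d) → Term V) → Term V
  h-tilde x y = h y ∧ₜ h-hat x y

  g : (Fin (suc d) → Term V) → Term V
  g y = ¬ₜ y zero ∧ₜ ⋀ (allFin d) (λ i → y zero ∨ₜ isolated y i)

  g-tilde : Term V → (Fin (suc d) → Term V) → Term V
  g-tilde x y = g y ∧ₜ ⋀ (allFin d) (λ i → y zero ∨ₜ (x ∧ₜ y (suc i)))

Seq : Set
Seq = ℕ → ℚ

infix 4 _~_

-- For Cauchy sequences this two-index form is equivalent to x n - y n → 0, and
-- x ~ x is literally the Cauchy condition.
_~_ : Seq → Seq → Set
x ~ y = ∀ ε → 0ℚ ℚ.< ε →
  ∃[ N ] ∀ m n → N ℕ.≤ m → N ℕ.≤ n → ℚ.∣ x m ℚ.- y n ∣ ℚ.< ε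

Cauchy : Seq → Set
Cauchy x = x ~ x

private
  module RingIdentities {c ℓ} (R : CommutativeRing c ℓ) where
    open CommutativeRing R
    open Algebra.Properties.Ring ring
    private
      open SemiringSolver commutativeSemiring using (solve; _:=_; _:+_; _:*_)

      neg : ∀ x → - x ≈ - 1# * x
      neg x = sym (-1*x≈-x x)

      sub : ∀ x y → x - y ≈ x + - 1# * y
      sub x y = +-congˡ (neg y)

    difference-flip : ∀ p q → - (p - q) ≈ q - p
    difference-flip = ⁻¹-anti-homo-//

    difference-of-sums : ∀ a b c d → (a - b) + (c - d) ≈ (a + c) - (b + d)
    difference-of-sums a b c d = trans
      (solve 4 (λ a b c d → ((a :+ b) :+ (c :+ d)) := ((a :+ c) :+ (b :+ d))) refl a (- b) c (- d))
      (+-congˡ (-‿+-comm b d))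

    difference-of-products : ∀ a b c d → a * (c - d) + d * (a - b) ≈ a * c - b * d
    difference-of-products a b c d = trans
      (+-cong (*-congˡ (sub c d)) (*-congˡ (sub a b))) (trans
      (solve 5 (λ a b c d s → (a :* (c :+ s :* d) :+ d :* (a :+ s :* b))
                            := ((a :* c :+ s :* (b :* d)) :+ (a :* d :+ s :* (a :* d)))) refl a b c d (- 1#)) (trans
      (sym (+-cong (sub (a * c) (b * d)) (sub (a * d) (a * d)))) (trans
      (+-congˡ (-‿inverseʳ (a * d))) (+-identityʳ _))))

    complex-assoc-re : ∀ a b c d e f →
      (a * c - b * d) * e - (a * d + b * c) * f ≈ a * (c * e - d * f) - b * (c * f + d * e)
    complex-assoc-re a b c d e f = trans
      (trans (sub _ _) (+-congʳ (*-congʳ (sub _ _)))) (trans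
      (solve 7 (λ a b c d e f s →
          ((a :* c :+ s :* (b :* d)) :* e :+ s :* ((a :* d :+ b :* c) :* f))
        := (a :* (c :* e :+ s :* (d :* f)) :+ s :* (b :* (c :* f :+ d :* e)))) refl a b c d e f (- 1#))
      (sym (trans (sub _ _) (+-congʳ (*-congˡ (sub _ _))))))

    complex-assoc-im : ∀ a b c d e f →
      (a * c - b * d) * f + (a * d + b * c) * e ≈ a * (c * f + d * e) + b * (c * e - d * f)
    complex-assoc-im a b c d e f = trans
      (+-congʳ (*-congʳ (sub _ _))) (trans
      (solve 7 (λ a b c d e f s →
          ((a :* c :+ s :* (b :* d)) :* f :+ (a :* d :+ b :* c) :* e)
        := (a :* (c :* f :+ d :* e) :+ b :* (c :* e :+ s :* (d :* f)))) refl a b c d e f (- 1#))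
      (sym (+-congˡ (*-congˡ (sub _ _)))))

    complex-distrib-re : ∀ a b c d e f →
      a * (c + e) - b * (d + f) ≈ (a * c - b * d) + (a * e - b * f)
    complex-distrib-re a b c d e f = trans
      (+-cong (distribˡ a c e) (-‿cong (distribˡ b d f)))
      (sym (difference-of-sums (a * c) (b * d) (a * e) (b * f)))

    complex-distrib-im : ∀ a b c d e f →
      a * (d + f) + b * (c + e) ≈ (a * d + b * c) + (a * f + b * e)
    complex-distrib-im = solve 6 (λ a b c d e f →
          (a :* (d :+ f) :+ b :* (c :+ e)) := ((a :* d :+ b :* c) :+ (a :* f :+ b :* e))) refl

    complex-identity-re : ∀ a b → 1# * a - 0# * b ≈ a
    complex-identity-re a b = trans
      (+-cong (*-identityˡ a) (trans (-‿cong (zeroˡ b)) -0#≈0#)) (+-identityʳ a)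

    complex-identity-im : ∀ a b → 1# * b + 0# * a ≈ b
    complex-identity-im a b = trans
      (+-cong (*-identityˡ b) (zeroˡ a)) (+-identityʳ b)

private
  module ℚR = RingIdentities ℚ.+-*-commutativeRing

  half-pos : ∀ {ε} → 0ℚ ℚ.< ε → 0ℚ ℚ.< ½ ℚ.* ε
  half-pos {ε} p = ℚ.positive⁻¹ (½ ℚ.* ε) {{ℚ.pos*pos⇒pos ½ ε {{ℚ.positive p}}}}

  half+half : ∀ ε → ½ ℚ.* ε ℚ.+ ½ ℚ.* ε ≡ ε
  half+half ε = ≡.trans (≡.sym (ℚ.*-distribʳ-+ ε ½ ½)) (ℚ.*-identityˡ ε)

  +-bound : ∀ {p q ε} → ℚ.∣ p ∣ ℚ.< ½ ℚ.* ε → ℚ.∣ q ∣ ℚ.< ½ ℚ.* ε → ℚ.∣ p ℚ.+ q ∣ ℚ.< ε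
  +-bound {p} {q} {ε} a b = begin-strict
    ℚ.∣ p ℚ.+ q ∣             ≤⟨ ℚ.∣p+q∣≤∣p∣+∣q∣ p q ⟩
    ℚ.∣ p ∣ ℚ.+ ℚ.∣ q ∣       <⟨ ℚ.+-mono-< a b ⟩
    ½ ℚ.* ε ℚ.+ ½ ℚ.* ε      ≡⟨ half+half ε ⟩
    ε                         ∎
    where open ℚ.≤-Reasoning

  ∣-∣-swap : ∀ p q → ℚ.∣ p ℚ.- q ∣ ≡ ℚ.∣ q ℚ.- p ∣
  ∣-∣-swap p q = ≡.trans (≡.sym (ℚ.∣-p∣≡∣p∣ (p ℚ.- q))) (≡.cong ℚ.∣_∣ (ℚR.difference-flip p q))

  ~-sym : ∀ {x y} → x ~ y → y ~ x
  ~-sym {x} {y} p ε ε>0 with p ε ε>0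
  ... | N , f = N , λ m n a b → ≡.subst (ℚ._< ε) (∣-∣-swap (x n) (y m)) (f n m b a)

  max₁ : ∀ {M N n} → M ℕ.⊔ N ℕ.≤ n → M ℕ.≤ n
  max₁ {M} {N} = ℕ.m⊔n≤o⇒m≤o M N

  max₂ : ∀ {M N n} → M ℕ.⊔ N ℕ.≤ n → N ℕ.≤ n
  max₂ {M} {N} = ℕ.m⊔n≤o⇒n≤o M N

  ~-trans : ∀ {x y z} → x ~ y → y ~ z → x ~ z
  ~-trans {x} {y} {z} p q ε ε>0 with p (½ ℚ.* ε) (half-pos ε>0) | q (½ ℚ.* ε) (half-pos ε>0)
  ... | M , f | N , g = M ℕ.⊔ N , λ m n a b →
    ≡.subst (λ r → ℚ.∣ r ∣ ℚ.< ε) (eq (x m) (y m) (z n))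
      (+-bound {x m ℚ.- y m} {y m ℚ.- z n} (f m m (max₁ a) (max₁ a)) (g m n (max₂ {M} a) (max₂ {M} b)))
    where
    eq : ∀ p q r → (p ℚ.- q) ℚ.+ (q ℚ.- r) ≡ p ℚ.- r
    eq p q r = ≡.trans (ℚ.+-assoc p (ℚ.- q) _) (≡.cong (p ℚ.+_)
      (≡.trans (≡.sym (ℚ.+-assoc (ℚ.- q) q _)) (≡.trans (≡.cong (ℚ._- r) (ℚ.+-inverseˡ q)) (ℚ.+-identityˡ _))))

  ~-pointwise : ∀ {x y} → Cauchy x → (∀ n → x n ≡ y n) → x ~ y
  ~-pointwise {x} {y} c e ε ε>0 with c ε ε>0
  ... | N , f = N , λ m n a b → ≡.subst (λ r → ℚ.∣ x m ℚ.- r ∣ ℚ.< ε) (e n) (f m n a b)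

  const-cauchy : ∀ q → Cauchy (λ _ → q)
  const-cauchy q ε ε>0 = 0 , λ _ _ _ _ → ≡.subst (λ r → ℚ.∣ r ∣ ℚ.< ε) (≡.sym (ℚ.+-inverseʳ q)) ε>0

  +-~ : ∀ {x x′ y y′} → x ~ x′ → y ~ y′ → (λ n → x n ℚ.+ y n) ~ (λ n → x′ n ℚ.+ y′ n)
  +-~ {x} {x′} {y} {y′} p q ε ε>0 with p (½ ℚ.* ε) (half-pos ε>0) | q (½ ℚ.* ε) (half-pos ε>0)
  ... | M , f | N , g = M ℕ.⊔ N , λ m n a b →
    ≡.subst (λ r → ℚ.∣ r ∣ ℚ.< ε) (ℚR.difference-of-sums (x m) (x′ n) (y m) (y′ n))
      (+-bound {x m ℚ.- x′ n} {y m ℚ.- y′ n} (f m n (max₁ a) (max₁ b)) (g m n (max₂ {M} a) (max₂ {M} b)))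

  neg-~ : ∀ {x x′} → x ~ x′ → (λ n → ℚ.- x n) ~ (λ n → ℚ.- x′ n)
  neg-~ {x} {x′} p ε ε>0 with p ε ε>0
  ... | N , f = N , λ m n a b →
    ≡.subst (ℚ._< ε) (≡.trans (≡.sym (ℚ.∣-p∣≡∣p∣ (x m ℚ.- x′ n))) (≡.cong ℚ.∣_∣ (ℚ.neg-distrib-+ (x m) (ℚ.- x′ n)))) (f m n a b)

  bounded : ∀ {x x′} → x ~ x′ → ∃[ B ] ℚ.Positive B × ∃[ N ] ∀ n → N ℕ.≤ n → ℚ.∣ x n ∣ ℚ.≤ B
  bounded {x} {x′} p with p 1ℚ (ℚ.positive⁻¹ 1ℚ)
  ... | N , f = 1ℚ ℚ.+ ℚ.∣ x′ N ∣
              , ℚ.positive (ℚ.+-mono-<-≤ (ℚ.positive⁻¹ 1ℚ) (ℚ.0≤∣p∣ (x′ N)))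
              , N , λ n a → begin
      ℚ.∣ x n ∣                                ≡⟨ ≡.cong ℚ.∣_∣ (eq (x n) (x′ N)) ⟩
      ℚ.∣ (x n ℚ.- x′ N) ℚ.+ x′ N ∣            ≤⟨ ℚ.∣p+q∣≤∣p∣+∣q∣ (x n ℚ.- x′ N) (x′ N) ⟩
      ℚ.∣ x n ℚ.- x′ N ∣ ℚ.+ ℚ.∣ x′ N ∣        ≤⟨ ℚ.+-monoˡ-≤ ℚ.∣ x′ N ∣ (ℚ.<⇒≤ (f n N a ℕ.≤-refl)) ⟩
      1ℚ ℚ.+ ℚ.∣ x′ N ∣                        ∎
    where
    open ℚ.≤-Reasoning
    eq : ∀ p q → p ≡ (p ℚ.- q) ℚ.+ q
    eq p q = ≡.sym (≡.trans (ℚ.+-assoc p (ℚ.- q) q) (≡.trans (≡.cong (p ℚ.+_) (ℚ.+-inverseˡ q)) (ℚ.+-identityʳ p)))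

  shrink : ∀ B → ℚ.Positive B → ∀ {ε} → 0ℚ ℚ.< ε →
    ∃[ δ ] 0ℚ ℚ.< δ × (∀ {p q} → ℚ.∣ p ∣ ℚ.≤ B → ℚ.∣ q ∣ ℚ.< δ → ℚ.∣ p ℚ.* q ∣ ℚ.< ε)
  shrink B B>0 {ε} ε>0 = δ , ℚ.positive⁻¹ δ , λ {p} {q} pB qδ → begin-strict
      ℚ.∣ p ℚ.* q ∣            ≡⟨ ℚ.∣p*q∣≡∣p∣*∣q∣ p q ⟩
      ℚ.∣ p ∣ ℚ.* ℚ.∣ q ∣      ≤⟨ ℚ.*-monoʳ-≤-nonNeg ℚ.∣ q ∣ {{ℚ.nonNegative (ℚ.0≤∣p∣ q)}} pB ⟩
      B ℚ.* ℚ.∣ q ∣            <⟨ ℚ.*-monoʳ-<-pos B qδ ⟩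
      B ℚ.* δ                  ≡⟨ ≡.sym (ℚ.*-assoc B (ℚ.1/ B) ε) ⟩
      B ℚ.* ℚ.1/ B ℚ.* ε       ≡⟨ ≡.cong (ℚ._* ε) (ℚ.*-inverseʳ B) ⟩
      1ℚ ℚ.* ε                 ≡⟨ ℚ.*-identityˡ ε ⟩
      ε                        ∎
    where
    open ℚ.≤-Reasoning
    instance
      B-pos = B>0
      B-nz = ℚ.pos⇒nonZero B
      1/B-pos = ℚ.1/pos⇒pos B
      ε-pos = ℚ.positive ε>0
    δ = ℚ.1/ B ℚ.* ε
    instance
      δ-pos = ℚ.pos*pos⇒pos (ℚ.1/ B) ε

  *-~ : ∀ {x x′ y y′} → x ~ x′ → y ~ y′ → (λ n → x n ℚ.* y n) ~ (λ n → x′ n ℚ.* y′ n)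
  *-~ {x} {x′} {y} {y′} p q ε ε>0
    with bounded {x} {x′} p | bounded {y′} {y} (~-sym {y} {y′} q)
  ... | B , B>0 , K , xB | C , C>0 , L , yC
    with shrink B B>0 (half-pos ε>0) | shrink C C>0 (half-pos ε>0)
  ... | δ , δ>0 , sB | γ , γ>0 , sC
    with p γ γ>0 | q δ δ>0
  ... | M , f | N , g = (K ℕ.⊔ L) ℕ.⊔ (M ℕ.⊔ N) , λ m n a b →
    ≡.subst (λ r → ℚ.∣ r ∣ ℚ.< ε) (ℚR.difference-of-products (x m) (x′ n) (y m) (y′ n))
      (+-bound {x m ℚ.* (y m ℚ.- y′ n)} {y′ n ℚ.* (x m ℚ.- x′ n)}
        (sB {x m} {y m ℚ.- y′ n} (xB m (max₁ {K} {L} (max₁ a))) (g m n (max₂ {M} (max₂ {K ℕ.⊔ L} a)) (max₂ {M} (max₂ {K ℕ.⊔ L} b))))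
        (sC {y′ n} {x m ℚ.- x′ n} (yC n (max₂ {K} (max₁ b))) (f m n (max₁ (max₂ {K ℕ.⊔ L} a)) (max₁ (max₂ {K ℕ.⊔ L} b)))))

record ℝ : Set where
  no-eta-equality
  field
    seq    : Seq
    cauchy : Cauchy seq

open ℝ public

infix 4 _≈ℝ_
infixl 6 _+ℝ_
infixl 7 _*ℝ_
infix 8 -ℝ_

-- A record rather than a synonym, so that x and y can be inferred from it.
record _≈ℝ_ (x y : ℝ) : Set where
  constructor equal
  field
    close : seq x ~ seq y

open _≈ℝ_ public

_+ℝ_ _*ℝ_ : ℝ → ℝ → ℝ
seq    (x +ℝ y) n = seq x n ℚ.+ seq y n
cauchy (x +ℝ y)   = +-~ {seq x} {seq x} {seq y} {seq y} (cauchy x) (cauchy y)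
seq    (x *ℝ y) n = seq x n ℚ.* seq y n
cauchy (x *ℝ y)   = *-~ {seq x} {seq x} {seq y} {seq y} (cauchy x) (cauchy y)

-ℝ_ : ℝ → ℝ
seq    (-ℝ x) n = ℚ.- seq x n
cauchy (-ℝ x)   = neg-~ {seq x} {seq x} (cauchy x)

0ℝ 1ℝ : ℝ
seq    0ℝ _ = 0ℚ
cauchy 0ℝ   = const-cauchy 0ℚ
seq    1ℝ _ = 1ℚ
cauchy 1ℝ   = const-cauchy 1ℚ

private
  pointwise : ∀ {x y} → (∀ n → seq x n ≡ seq y n) → x ≈ℝ y
  pointwise {x} {y} e = equal (~-pointwise {seq x} {seq y} (cauchy x) e)

  +ℝ-cong : ∀ {x y u v} → x ≈ℝ y → u ≈ℝ v → x +ℝ u ≈ℝ y +ℝ v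
  +ℝ-cong {x} {y} {u} {v} p q = equal (+-~ {seq x} {seq y} {seq u} {seq v} (close p) (close q))

  *ℝ-cong : ∀ {x y u v} → x ≈ℝ y → u ≈ℝ v → x *ℝ u ≈ℝ y *ℝ v
  *ℝ-cong {x} {y} {u} {v} p q = equal (*-~ {seq x} {seq y} {seq u} {seq v} (close p) (close q))

  -ℝ-cong : ∀ {x y} → x ≈ℝ y → -ℝ x ≈ℝ -ℝ y
  -ℝ-cong {x} {y} p = equal (neg-~ {seq x} {seq y} (close p))

  ≈ℝ-isEquivalence : IsEquivalence _≈ℝ_
  ≈ℝ-isEquivalence = record
    { refl  = λ {x} → equal (cauchy x)
    ; sym   = λ {x} {y} p → equal (~-sym {seq x} {seq y} (close p))
    ; trans = λ {x} {y} {z} p q → equal (~-trans {seq x} {seq y} {seq z} (close p) (close q))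
    }

ℝ-commutativeRing : CommutativeRing 0ℓ 0ℓ
ℝ-commutativeRing = record
  { Carrier = ℝ ; _≈_ = _≈ℝ_ ; _+_ = _+ℝ_ ; _*_ = _*ℝ_ ; -_ = -ℝ_ ; 0# = 0ℝ ; 1# = 1ℝ
  ; isCommutativeRing = record
    { isRing = record
      { +-isAbelianGroup = record
        { isGroup = record
          { isMonoid = record
            { isSemigroup = record
              { isMagma = record { isEquivalence = ≈ℝ-isEquivalence ; ∙-cong = +ℝ-cong }
              ; assoc   = λ x y z → pointwise λ n → ℚ.+-assoc (seq x n) (seq y n) (seq z n) }
            ; identity = (λ x → pointwise λ n → ℚ.+-identityˡ (seq x n))
                       , (λ x → pointwise λ n → ℚ.+-identityʳ (seq x n)) }
          ; inverse = (λ x → pointwise λ n → ℚ.+-inverseˡ (seq x n))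
                    , (λ x → pointwise λ n → ℚ.+-inverseʳ (seq x n))
          ; ⁻¹-cong = -ℝ-cong }
        ; comm = λ x y → pointwise λ n → ℚ.+-comm (seq x n) (seq y n) }
      ; *-cong = *ℝ-cong
      ; *-assoc = λ x y z → pointwise λ n → ℚ.*-assoc (seq x n) (seq y n) (seq z n)
      ; *-identity = (λ x → pointwise λ n → ℚ.*-identityˡ (seq x n))
                   , (λ x → pointwise λ n → ℚ.*-identityʳ (seq x n))
      ; distrib = (λ x y z → pointwise λ n → ℚ.*-distribˡ-+ (seq x n) (seq y n) (seq z n))
                , (λ x y z → pointwise λ n → ℚ.*-distribʳ-+ (seq x n) (seq y n) (seq z n))
      }
    ; *-comm = λ x y → pointwise λ n → ℚ.*-comm (seq x n) (seq y n) } }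

infix 4 _≈ℂ_
infixl 6 _+ℂ_
infixl 7 _*ℂ_
infix 8 -ℂ_

record ℂ : Set where
  constructor _+i_
  field
    re im : ℝ

open ℂ public

_≈ℂ_ : ℂ → ℂ → Set
z ≈ℂ w = re z ≈ℝ re w × im z ≈ℝ im w

_+ℂ_ _*ℂ_ : ℂ → ℂ → ℂ
z +ℂ w = (re z +ℝ re w) +i (im z +ℝ im w)
z *ℂ w = (re z *ℝ re w +ℝ -ℝ (im z *ℝ im w)) +i (re z *ℝ im w +ℝ im z *ℝ re w)

-ℂ_ conj : ℂ → ℂ
-ℂ z   = (-ℝ re z) +i (-ℝ im z)
conj z = re z +i (-ℝ im z)

0ℂ 1ℂ : ℂ
0ℂ = 0ℝ +i 0ℝ
1ℂ = 1ℝ +i 0ℝ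

ℂ-commutativeRing : CommutativeRing 0ℓ 0ℓ
ℂ-commutativeRing = record
  { Carrier = ℂ ; _≈_ = _≈ℂ_ ; _+_ = _+ℂ_ ; _*_ = _*ℂ_ ; -_ = -ℂ_ ; 0# = 0ℂ ; 1# = 1ℂ
  ; isCommutativeRing = record
    { isRing = record
      { +-isAbelianGroup = record
        { isGroup = record
          { isMonoid = record
            { isSemigroup = record
              { isMagma = record
                { isEquivalence = record
                  { refl  = ≈-refl , ≈-refl
                  ; sym   = λ (p , q) → ≈-sym p , ≈-sym q
                  ; trans = ≈ℂ-trans }
                ; ∙-cong = λ (p , q) (p′ , q′) → +-cong p p′ , +-cong q q′ }
              ; assoc = λ z w u → +-assoc (re z) (re w) (re u) , +-assoc (im z) (im w) (im u) }
            ; identity = (λ z → +-identityˡ (re z) , +-identityˡ (im z))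
                       , (λ z → +-identityʳ (re z) , +-identityʳ (im z)) }
          ; inverse = (λ z → -‿inverseˡ (re z) , -‿inverseˡ (im z))
                    , (λ z → -‿inverseʳ (re z) , -‿inverseʳ (im z))
          ; ⁻¹-cong = λ (p , q) → -‿cong p , -‿cong q }
        ; comm = λ z w → +-comm (re z) (re w) , +-comm (im z) (im w) }
      ; *-cong = λ (p , q) (p′ , q′) →
            +-cong (*-cong p p′) (-‿cong (*-cong q q′))
          , +-cong (*-cong p q′) (*-cong q p′)
      ; *-assoc = λ z w u →
            complex-assoc-re (re z) (im z) (re w) (im w) (re u) (im u)
          , complex-assoc-im (re z) (im z) (re w) (im w) (re u) (im u)
      ; *-identity = *ℂ-identityˡ
                   , λ z → ≈ℂ-trans (*ℂ-comm z 1ℂ) (*ℂ-identityˡ z)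
      ; distrib = distribˡ-ℂ
                , λ z w u → ≈ℂ-trans (*ℂ-comm (w +ℂ u) z)
                    (≈ℂ-trans (distribˡ-ℂ z w u)
                      ( +-cong (proj₁ (*ℂ-comm z w)) (proj₁ (*ℂ-comm z u))
                      , +-cong (proj₂ (*ℂ-comm z w)) (proj₂ (*ℂ-comm z u)))) }
    ; *-comm = *ℂ-comm } }
  where
  open CommutativeRing ℝ-commutativeRing
    renaming (refl to ≈-refl; sym to ≈-sym; trans to ≈-trans)
  open RingIdentities ℝ-commutativeRing

  ≈ℂ-trans : ∀ {z w u} → z ≈ℂ w → w ≈ℂ u → z ≈ℂ u
  ≈ℂ-trans (p , q) (p′ , q′) = ≈-trans p p′ , ≈-trans q q′

  *ℂ-comm : ∀ z w → z *ℂ w ≈ℂ w *ℂ z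
  *ℂ-comm z w =
      +-cong (*-comm (re z) (re w)) (-‿cong (*-comm (im z) (im w)))
    , ≈-trans (+-comm (re z *ℝ im w) (im z *ℝ re w))
        (+-cong (*-comm (im z) (re w)) (*-comm (re z) (im w)))

  *ℂ-identityˡ : ∀ z → 1ℂ *ℂ z ≈ℂ z
  *ℂ-identityˡ z = complex-identity-re (re z) (im z) , complex-identity-im (re z) (im z)

  distribˡ-ℂ : ∀ z w u → z *ℂ (w +ℂ u) ≈ℂ z *ℂ w +ℂ z *ℂ u
  distribˡ-ℂ z w u =
      complex-distrib-re (re z) (im z) (re w) (im w) (re u) (im u)
    , complex-distrib-im (re z) (im z) (re w) (im w) (re u) (im u)

record StarSubfield f : Set (lsuc f) where
  field
    Member    : Pred ℂ f
    resp      : ∀ {z w} → z ≈ℂ w → Member z → Member w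
    0-closed  : Member 0ℂ
    1-closed  : Member 1ℂ
    +-closed  : ∀ {z w} → Member z → Member w → Member (z +ℂ w)
    *-closed  : ∀ {z w} → Member z → Member w → Member (z *ℂ w)
    neg-closed  : ∀ {z} → Member z → Member (-ℂ z)
    inv-closed  : ∀ {z} → Member z → ¬ z ≈ℂ 0ℂ → ∃[ w ] Member w × z *ℂ w ≈ℂ 1ℂ
    conj-closed : ∀ {z} → Member z → Member (conj z)

  infix 4 _≈F_

  -- As for ℝ, a record wrapper around equality in ℂ of the underlying numbers.
  record _≈F_ (z w : ∃ Member) : Set where
    constructor equalF
    field
      underlying : proj₁ z ≈ℂ proj₁ w

  open _≈F_ public

  rawRing : RawRing f 0ℓ
  rawRing = record
    { Carrier = ∃ Member
    ; _≈_ = _≈F_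
    ; _+_ = λ (z , p) (w , q) → z +ℂ w , +-closed p q
    ; _*_ = λ (z , p) (w , q) → z *ℂ w , *-closed p q
    ; -_  = λ (z , p) → -ℂ z , neg-closed p
    ; 0#  = 0ℂ , 0-closed
    ; 1#  = 1ℂ , 1-closed
    }

  private
    inclusion : IsRingMonomorphism rawRing (CommutativeRing.rawRing ℂ-commutativeRing) proj₁
    inclusion = record
      { isRingHomomorphism = record
        { isSemiringHomomorphism = record
          { isNearSemiringHomomorphism = record
            { +-isMonoidHomomorphism = record
              { isMagmaHomomorphism = record
                { isRelHomomorphism = record { cong = underlying }
                ; homo = λ (z , _) (w , _) → refl {z +ℂ w} }
              ; ε-homo = refl {0ℂ} }
            ; *-homo = λ (z , _) (w , _) → refl {z *ℂ w} }
          ; 1#-homo = refl {1ℂ} }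
        ; -‿homo = λ (z , _) → refl { -ℂ z } }
      ; injective = equalF }
      where open CommutativeRing ℂ-commutativeRing using (refl)

  commutativeRing : CommutativeRing f 0ℓ
  commutativeRing = record
    { isCommutativeRing = RingMonomorphism.isCommutativeRing inclusion
        (CommutativeRing.isCommutativeRing ℂ-commutativeRing) }

  open CommutativeRing commutativeRing public hiding (rawRing)

  conjugate : Carrier → Carrier
  conjugate (z , p) = conj z , conj-closed p

record UnitarySpace {f} (F : StarSubfield f) m ℓm : Set (f ⊔ lsuc (m ⊔ ℓm)) where
  private module F = StarSubfield F
  field
    leftModule : LeftModule F.ring m ℓm

  open LeftModule leftModule public

  field
    ⟨_∣_⟩       : Carrierᴹ → Carrierᴹ → F.Carrier
    ⟨∣⟩-cong    : ∀ {x x′ y y′} → x ≈ᴹ x′ → y ≈ᴹ y′ → ⟨ x ∣ y ⟩ F.≈ ⟨ x′ ∣ y′ ⟩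
    additive    : ∀ x y z → ⟨ x ∣ y +ᴹ z ⟩ F.≈ ⟨ x ∣ y ⟩ F.+ ⟨ x ∣ z ⟩
    homogeneous : ∀ a x y → ⟨ x ∣ a *ₗ y ⟩ F.≈ a F.* ⟨ x ∣ y ⟩
    hermitian   : ∀ x y → ⟨ y ∣ x ⟩ F.≈ F.conjugate ⟨ x ∣ y ⟩
    anisotropic : ∀ x → ¬ x ≈ᴹ 0ᴹ → ¬ ⟨ x ∣ x ⟩ F.≈ F.0#

module _ {f m ℓm} {F : StarSubfield f} (H : UnitarySpace F m ℓm) where
  private module F = StarSubfield F
  open UnitarySpace H
  open Sum +ᴹ-commutativeMonoid using (sum)

  record IsBasis {n} (b : Fin n → Carrierᴹ) : Set (f ⊔ m ⊔ ℓm) where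
    field
      spanning    : ∀ x → ∃ λ (λs : Fin n → F.Carrier) → x ≈ᴹ sum (λ i → λs i *ₗ b i)
      independent : ∀ (λs : Fin n → F.Carrier) →
        sum (λ i → λs i *ₗ b i) ≈ᴹ 0ᴹ → ∀ i → λs i F.≈ F.0#

  FiniteDimensional : Set (f ⊔ m ⊔ ℓm)
  FiniteDimensional = ∃[ n ] ∃[ b ] IsBasis {n} b

  NonTrivial : Set (m ⊔ ℓm)
  NonTrivial = ∃[ x ] ¬ x ≈ᴹ 0ᴹ

  record Subspace : Set (f ⊔ lsuc (m ⊔ ℓm)) where
    field
      Member    : Pred Carrierᴹ (m ⊔ ℓm)
      resp      : ∀ {x y} → x ≈ᴹ y → Member x → Member y
      0-closed  : Member 0ᴹ
      +-closed  : ∀ {x y} → Member x → Member y → Member (x +ᴹ y)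
      *ₗ-closed : ∀ a {x} → Member x → Member (a *ₗ x)

  open Subspace

  infix 8 _⊥
  infixl 6 _+ₛ_
  infixl 7 _∩ₛ_

  0ₛ Hₛ : Subspace
  0ₛ = record
    { Member    = λ x → Lift m (x ≈ᴹ 0ᴹ)
    ; resp      = λ p (lift q) → lift (≈ᴹ-trans (≈ᴹ-sym p) q)
    ; 0-closed  = lift ≈ᴹ-refl
    ; +-closed  = λ (lift p) (lift q) → lift (≈ᴹ-trans (+ᴹ-cong p q) (+ᴹ-identityˡ 0ᴹ))
    ; *ₗ-closed = λ a (lift p) → lift (≈ᴹ-trans (*ₗ-cong F.refl p) (*ₗ-zeroʳ a))
    }
  Hₛ = record { Member = λ _ → ⊤ }

  _∩ₛ_ _+ₛ_ : Subspace → Subspace → Subspace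
  U ∩ₛ W = record
    { Member    = λ x → Member U x × Member W x
    ; resp      = λ e (p , q) → resp U e p , resp W e q
    ; 0-closed  = 0-closed U , 0-closed W
    ; +-closed  = λ (p , q) (p′ , q′) → +-closed U p p′ , +-closed W q q′
    ; *ₗ-closed = λ a (p , q) → *ₗ-closed U a p , *ₗ-closed W a q
    }
  U +ₛ W = record
    { Member    = λ x → ∃[ u ] ∃[ w ] Member U u × Member W w × x ≈ᴹ u +ᴹ w
    ; resp      = λ e (u , w , p , q , r) → u , w , p , q , ≈ᴹ-trans (≈ᴹ-sym e) r
    ; 0-closed  = 0ᴹ , 0ᴹ , 0-closed U , 0-closed W , ≈ᴹ-sym (+ᴹ-identityˡ 0ᴹ)
    ; +-closed  = λ (u , w , p , q , r) (u′ , w′ , p′ , q′ , r′) →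
        u +ᴹ u′ , w +ᴹ w′ , +-closed U p p′ , +-closed W q q′
        , ≈ᴹ-trans (+ᴹ-cong r r′) (interchange u w u′ w′)
    ; *ₗ-closed = λ a (u , w , p , q , r) →
        a *ₗ u , a *ₗ w , *ₗ-closed U a p , *ₗ-closed W a q
        , ≈ᴹ-trans (*ₗ-cong F.refl r) (*ₗ-distribˡ a u w)
    }
    where
    open CommutativeSemigroupProperties
      (CommutativeMonoid.commutativeSemigroup +ᴹ-commutativeMonoid) using (interchange)

  _⊥ : Subspace → Subspace
  W ⊥ = record
    { Member    = λ x → ∀ w → Member W w → Lift (m ⊔ ℓm) (⟨ w ∣ x ⟩ F.≈ F.0#)
    ; resp      = λ e p w q → lift (F.trans (F.sym (⟨∣⟩-cong ≈ᴹ-refl e)) (lower (p w q)))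
    ; 0-closed  = λ w _ → lift (F.trans (⟨∣⟩-cong ≈ᴹ-refl (≈ᴹ-sym (*ₗ-zeroˡ 0ᴹ)))
        (F.trans (homogeneous F.0# w 0ᴹ) (F.zeroˡ ⟨ w ∣ 0ᴹ ⟩)))
    ; +-closed  = λ {x} {y} p p′ w q → lift (F.trans (additive w x y)
        (F.trans (F.+-cong (lower (p w q)) (lower (p′ w q))) (F.+-identityˡ F.0#)))
    ; *ₗ-closed = λ a {x} p w q → lift (F.trans (homogeneous a w x)
        (F.trans (F.*-cong (F.refl {a}) (lower (p w q))) (F.zeroʳ a)))
    }

  subspaceOrtholattice : RawOrtholattice (f ⊔ lsuc (m ⊔ ℓm)) (m ⊔ ℓm)
  subspaceOrtholattice = record
    { Carrier = Subspace
    ; _≈_ = λ U W → Member U ⊆ Member W × Member W ⊆ Member U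
    ; _∧_ = _∩ₛ_ ; _∨_ = _+ₛ_ ; ∼_ = _⊥ ; 0# = 0ₛ ; 1# = Hₛ
    }

-- Polynomial time is that of deterministic multitape Turing machines with
-- two-way infinite tapes.

data Symbol (k : ℕ) : Set where
  blank : Symbol k
  bit   : Bool → Symbol k
  aux   : Fin k → Symbol k

data Move : Set where
  left stay right : Move

-- `before` lists the cells left of the head, nearest first, and `after` those
-- right of it; all cells beyond either list are blank.
record Tape (k : ℕ) : Set where
  constructor tape
  field
    before  : List (Symbol k)
    scanned : Symbol k
    after   : List (Symbol k)

open Tape public using (scanned)

writeAndMove : ∀ {k} → Symbol k × Move → Tape k → Tape k
writeAndMove (s , left)  (tape []      _ as)       = tape [] blank (s ∷ as)
writeAndMove (s , left)  (tape (b ∷ bs) _ as)      = tape bs b (s ∷ as)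
writeAndMove (s , stay)  (tape bs      _ as)       = tape bs s as
writeAndMove (s , right) (tape bs      _ [])       = tape (s ∷ bs) blank []
writeAndMove (s , right) (tape bs      _ (a ∷ as)) = tape (s ∷ bs) a as

emptyTape : ∀ {k} → Tape k
emptyTape = tape [] blank []

loadTape : ∀ {k} → List Bool → Tape k
loadTape []       = emptyTape
loadTape (b ∷ bs) = tape [] (bit b) (List.map bit bs)

-- The longest block of bits starting at the head and extending to the right.
readTape : ∀ {k} → Tape k → List Bool
readTape (tape _ s as) = bits (s ∷ as)
  where
  bits : ∀ {k} → List (Symbol k) → List Bool
  bits (bit b ∷ ss) = b ∷ bits ss
  bits _            = []

record TuringMachine : Set₁ where
  field
    tapeCount auxCount stateCount : ℕ
    State   : Set
    finite  : State ↔ Fin stateCount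
    start   : State
    input output : Fin tapeCount
    -- `nothing` means that the machine halts.
    δ : State → Vec (Symbol auxCount) tapeCount →
        Maybe (State × Vec (Symbol auxCount × Move) tapeCount)

  Config : Set
  Config = State × Vec (Tape auxCount) tapeCount

  initial : List Bool → Config
  initial s = start , Vec.replicate tapeCount emptyTape [ input ]≔ loadTape s

  step : Config → Maybe Config
  step (q , ts) =
    Maybe.map (λ (q′ , actions) → q′ , Vec.zipWith writeAndMove actions ts)
              (δ q (Vec.map scanned ts))

  run : ℕ → Config → Config
  run zero    c = c
  run (suc n) c = maybe′ (run n) c (step c)

  result : Config → List Bool
  result (_ , ts) = readTape (Vec.lookup ts output)

  Computes_within_ : (List Bool → List Bool) → (ℕ → ℕ) → Set
  Computes f within T = ∀ s → ∃[ n ] n ℕ.≤ T (length s)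
    × step (run n (initial s)) ≡ nothing
    × result (run n (initial s)) ≡ f s

PolynomialTime : (List Bool → List Bool) → Set₁
PolynomialTime f = ∃[ M ] ∃[ c ] ∃[ e ]
  TuringMachine.Computes_within_ M f (λ n → c ℕ.* n ℕ.^ e ℕ.+ c)

infix 4 _≼_

_≼_ : ∀ {a b} → Pred (List Bool) a → Pred (List Bool) b → Set (lsuc 0ℓ ⊔ a ⊔ b)
A ≼ B = ∃[ f ] PolynomialTime f × (∀ s → s ∈ A ⇔ f s ∈ B)

-- Binary digits (least significant first), each preceded by a continuation
-- bit, so that the code is self-delimiting.
encodeIndex : ℕᵇ → List Bool
encodeIndex zero     = false ∷ []
encodeIndex 2[1+ n ] = true ∷ false ∷ encodeIndex n
encodeIndex 1+[2 n ] = true ∷ true ∷ encodeIndex n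

-- Polish notation with three-bit symbols.
encode : Term ℕ → List Bool
encode 0ₜ       = false ∷ false ∷ false ∷ []
encode 1ₜ       = false ∷ false ∷ true ∷ []
encode (¬ₜ t)   = false ∷ true ∷ false ∷ encode t
encode (s ∧ₜ t) = false ∷ true ∷ true ∷ encode s ++ encode t
encode (s ∨ₜ t) = true ∷ false ∷ false ∷ encode s ++ encode t
encode (var n)  = true ∷ false ∷ true ∷ encodeIndex (fromℕ n)

module _ {c ℓ} (L : RawOrtholattice c ℓ) where

  SAT sat : Pred (List Bool) (c ⊔ ℓ)
  SAT s = ∃[ t ] encode t ≡ s × StronglySatisfiable L t
  sat s = ∃[ t ] encode t ≡ s × WeaklySatisfiable L t

{-# OPTIONS --safe #-}
-- A composition series c₀ ≤ … ≤ c_d of a modular lattice yields a strictly monotone rank with values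
-- in {0, …, d}: count the i for which (z ∧ c_{i+1}) ∨ c_i = c_{i+1}.  Hence d pairwise orthogonal
-- nonzero elements are atoms and join to 1.  In h̃ the Sasaki projection of x ≠ 0 to some y_i is
-- nonzero, thus equal to y_i, and y₀ transports it to every y_j; in g̃ ≠ 0 all the y_i are atoms that
-- meet x, thus lie below it.
--
-- In L(H), Gram–Schmidt gives orthogonal axes; the flag they span is a composition series, and the
-- axes together with the hyperplane orthogonal to the sum of the axes form a diamond.
--
-- A machine that rewinds its input for each occurrence of x writes h̃ or g̃ with t for x in linear
-- time.  Moving the variables of t to odd indices leaves the even ones for ȳ, and one counter, the
-- number of terms still to be read, tells whether the input codes a term at all.

module Submission where

open import Defs
open import Algebra.Bundles using (CommutativeRing)
import Algebra.Properties.CommutativeMonoid.Sum as Sum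
import Algebra.Properties.Ring as RingProperties
open import Axiom.ExcludedMiddle using (ExcludedMiddle)
open import Data.Bool.Base using (Bool; true; false)
open import Data.Empty using (⊥-elim)
open import Data.Fin using (#_)
open import Data.Fin.Base as Fin using (Fin; zero; suc; inject₁)
open import Data.Fin.Induction using (<-weakInduction)
import Data.Fin.Properties as Fin
open import Data.List.Base using (List; []; _∷_; _++_; _ʳ++_; allFin; length; map; replicate; reverse)
open import Data.List.Membership.Propositional using (_∈_)
open import Data.List.Membership.Propositional.Properties
  using (∈-allFin; ∈-filter⁺; ∈-filter⁻; ∈-++⁺ˡ; ∈-++⁺ʳ)
import Data.List.Properties as List
open import Data.List.Relation.Unary.Any using (here; there)
open import Data.Maybe.Base as Maybe using (Maybe; just; nothing; maybe′)
open import Data.Nat.Base as ℕ using (ℕ; zero; suc; NonZero; _+_; _*_; _^_; pred)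
open import Data.Nat.Binary.Base using (ℕᵇ; zero; 2[1+_]; 1+[2_]; fromℕ; toℕ)
import Data.Nat.Binary.Properties as ℕᵇ
import Data.Nat.Properties as ℕ
open import Data.Nat.Solver using (module +-*-Solver)
open import Data.Product.Base using (∃; ∃-syntax; _×_; _,_; proj₁; proj₂)
open import Data.Product.Function.NonDependent.Propositional using (_×-↔_)
open import Data.Sum.Base using (_⊎_; inj₁; inj₂; [_,_]′)
open import Data.Unit.Base using (⊤; tt)
open import Data.Vec.Base as Vec using (Vec; []; _∷_)
import Data.Vec.Functional as Vector
open import Function.Base using (_∘_; id; const)
open import Function.Bundles using (_⇔_; _↔_; mk⇔; mk↔ₛ′; Equivalence)
open import Function.Construct.Composition using (_↔-∘_)
open import Function.Construct.Identity using (↔-id)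
open import Function.Construct.Symmetry using (↔-sym)
open import Level using (Level; _⊔_; Lift; lift; lower)
open import Relation.Binary.PropositionalEquality as ≡ using (_≡_; refl)
open import Relation.Nullary.Decidable using (yes; no; ¬?; decidable-stable; from-yes)
open import Relation.Nullary.Negation using (¬_; contradiction)
open import Relation.Unary using (Pred)
open +-*-Solver using (solve; _:=_; _:+_; _:*_; con)

-- Modular ortholattices

-- Since the rank is computed along one fixed series, different maximal chains never have to be
-- compared. The series is also the common interface of both halves of the theorem: a maximal chain
-- supplies it in an abstract lattice, the flag of a frame in L(H). The directions of the two
-- equivalences rest on different facts. A value 1 of h̃ refutes x = 0 in any nontrivial lattice. A
-- nonzero value of g̃ produces its own full orthogonal family: the form of the isolated terms
-- forces orthogonality, and the factor `¬ₜ y zero` keeps every member from vanishing. The diamond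
-- serves the opposite directions, as the value of ȳ. In L(H) the obstacle is that a subspace is a
-- bare predicate without a basis. That a subspace and its orthocomplement span the space is
-- therefore proved by climbing the flag, with excluded middle deciding at each step whether the
-- subspace grows; lying in a span is expressed dually, by orthogonality. A reduction must also send
-- strings that code no term to strings that code none; the empty output serves for this.

module OrtholatticeProperties {c ℓ₁ ℓ₂} (L : ModularOrtholattice c ℓ₁ ℓ₂) where
  open ModularOrtholattice L renaming (refl to ≤-refl; trans to ≤-trans; reflexive to ≤-reflexive)

  ∼-swap : ∀ {x y} → x ≤ ∼ y → y ≤ ∼ x
  ∼-swap p = ≤-trans (≤-reflexive (Eq.sym (∼-involutive _))) (∼-antitone p)

  ∼1≤0 : ∼ 1# ≤ 0#
  ∼1≤0 = ≤-trans (∧-greatest (maximum _) ≤-refl) (≤-reflexive (∧-complement 1#))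

  disjoint : ∀ {x y} → x ≤ ∼ y → x ∧ y ≤ 0#
  disjoint {x} {y} p = ≤-trans
    (∧-greatest (x∧y≤y x y) (≤-trans (x∧y≤x x y) p)) (≤-reflexive (∧-complement y))

  x∨∼x : ∀ x → 1# ≤ x ∨ ∼ x
  x∨∼x x = ≤-reflexive (Eq.sym (∨-complement x))

  ∼-∧ : ∀ x y → ∼ (x ∧ y) ≤ ∼ x ∨ ∼ y
  ∼-∧ x y = ≤-trans
    (∼-antitone (∧-greatest (below (x≤x∨y _ _)) (below (y≤x∨y _ _))))
    (≤-reflexive (∼-involutive _))
    where
    below : ∀ {u v} → ∼ u ≤ v → ∼ v ≤ u
    below p = ≤-trans (∼-antitone p) (≤-reflexive (∼-involutive _))

  ∨-disjunctive : ∀ {x y} → y ≤ 0# → x ∨ y ≤ x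
  ∨-disjunctive p = ∨-least ≤-refl (≤-trans p (minimum _))

  -- The modular law rewrites `(x ∨ z) ∧ y` as `x ∨ (z ∧ y)`. In this form, that comparable elements
  -- with a common relative complement coincide, modularity is used in all lattice arguments below.
  modular-cancel : ∀ {x y} z → x ≤ y → y ∧ z ≤ x → y ≤ x ∨ z → y ≤ x
  modular-cancel {x} {y} z x≤y y∧z≤x y≤x∨z = ≤-trans (∧-greatest y≤x∨z ≤-refl)
    (≤-trans (≤-reflexive (Eq.sym (modular x z y x≤y)))
      (∨-least ≤-refl (≤-trans (∧-greatest (x∧y≤y z y) (x∧y≤x z y)) y∧z≤x)))

  -- If the Sasaki projection of `x` to `y` vanishes, then `∼ y` and `x ∨ ∼ y` both have meet 0 and
  -- join 1 with `y`, so cancellation identifies them.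
  sasaki-zero : ∀ {x y} → (x ∨ ∼ y) ∧ y ≤ 0# → x ≤ ∼ y
  sasaki-zero {x} {y} p = ≤-trans (x≤x∨y x (∼ y))
    (modular-cancel y (y≤x∨y x (∼ y)) (≤-trans p (minimum _))
      (≤-trans (maximum _) (≤-trans (x∨∼x y) (∨-least (y≤x∨y _ _) (x≤x∨y _ _)))))

  ⨆ : ∀ {n} → (Fin n → Carrier) → Carrier
  ⨆ = Vector.foldr _∨_ 0#

  ⨆-upper : ∀ {n} (a : Fin n → Carrier) i → a i ≤ ⨆ a
  ⨆-upper a zero    = x≤x∨y _ _
  ⨆-upper a (suc i) = ≤-trans (⨆-upper (a ∘ suc) i) (y≤x∨y _ _)

  ⨆-least : ∀ {n} (a : Fin n → Carrier) {x} → (∀ i → a i ≤ x) → ⨆ a ≤ x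
  ⨆-least {zero}  a p = minimum _
  ⨆-least {suc n} a p = ∨-least (p zero) (⨆-least (a ∘ suc) (p ∘ suc))

  PairwiseOrthogonal : ∀ {n} → (Fin n → Carrier) → Set ℓ₂
  PairwiseOrthogonal a = ∀ i j → ¬ i ≡ j → a i ≤ ∼ a j

  AllNonZero : ∀ {n} → (Fin n → Carrier) → Set ℓ₂
  AllNonZero a = ∀ i → ¬ a i ≤ 0#

  tail-orthogonal : ∀ {n} {a : Fin (suc n) → Carrier} →
    PairwiseOrthogonal a → PairwiseOrthogonal (a ∘ suc)
  tail-orthogonal orth i j i≢j = orth (suc i) (suc j) (i≢j ∘ Fin.suc-injective)

  head-orthogonal : ∀ {n} {a : Fin (suc n) → Carrier} →
    PairwiseOrthogonal a → a zero ∧ ⨆ (a ∘ suc) ≤ 0#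
  head-orthogonal {a = a} orth =
    disjoint (∼-swap (⨆-least (a ∘ suc) λ j → orth (suc j) zero λ ()))

  -- Composition series and rank

  -- Indexed by length and top, so that the rank can recurse from the top factor downwards.
  data CompositionSeries : ℕ → Carrier → Set (c ⊔ ℓ₂) where
    bottom : ∀ {x} → x ≤ 0# → CompositionSeries 0 x
    cover  : ∀ {n x y} → CompositionSeries n x → x ≤ y →
             (∀ z → x ≤ z → z ≤ y → z ≤ x ⊎ y ≤ z) → CompositionSeries (suc n) y

  compositionSeries : ∀ {n} (a : Fin (suc n) → Carrier) → a zero ≤ 0# →
    (∀ i → a (inject₁ i) ≤ a (suc i)) →
    (∀ i z → a (inject₁ i) ≤ z → z ≤ a (suc i) → z ≤ a (inject₁ i) ⊎ a (suc i) ≤ z) →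
    CompositionSeries n (a (Fin.fromℕ n))
  compositionSeries {zero}  a a≤0 _ _ = bottom a≤0
  compositionSeries {suc n} a a≤0 mono cov = cover
    (compositionSeries (a ∘ inject₁) a≤0 (mono ∘ inject₁) (cov ∘ inject₁))
    (mono (Fin.fromℕ n)) (cov (Fin.fromℕ n))

  module MaximalChain {d} {chain : Fin (suc d) → Carrier} (isMax : IsMaximalChain L chain) where
    open IsMaximalChain isMax

    chain-mono : ∀ {i j} → i Fin.≤ j → chain i ≤ chain j
    chain-mono {i} {j} i≤j with ℕ.m≤n⇒m<n∨m≡n i≤j
    ... | inj₁ i<j = proj₁ (strict i j i<j)
    ... | inj₂ i≡j = ≤-reflexive (Eq.reflexive (≡.cong chain (Fin.toℕ-injective i≡j)))

    bottom-zero : chain zero ≤ 0#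
    bottom-zero with maximal 0# (λ _ → inj₁ (minimum _))
    ... | i , 0≈ = ≤-trans (chain-mono ℕ.z≤n) (≤-reflexive (Eq.sym 0≈))

    top-one : 1# ≤ chain (Fin.fromℕ d)
    top-one with maximal 1# (λ _ → inj₂ (maximum _))
    ... | i , 1≈ = ≤-trans (≤-reflexive 1≈) (chain-mono (Fin.≤fromℕ i))

    step-mono : ∀ i → chain (inject₁ i) ≤ chain (suc i)
    step-mono i = chain-mono (ℕ.≤-trans (ℕ.≤-reflexive (Fin.toℕ-inject₁ i)) (ℕ.n≤1+n _))

    -- An element between two consecutive members is comparable with the whole chain, so maximality
    -- puts it into the chain; its index decides on which side it falls.
    covering : ∀ i z → chain (inject₁ i) ≤ z → z ≤ chain (suc i) →
      z ≤ chain (inject₁ i) ⊎ chain (suc i) ≤ z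
    covering i z lo hi with maximal z comparable
      where
      comparable : ∀ j → z ≤ chain j ⊎ chain j ≤ z
      comparable j with j Fin.≤? inject₁ i
      ... | yes j≤i = inj₂ (≤-trans (chain-mono j≤i) lo)
      ... | no  j≰i = inj₁ (≤-trans hi (chain-mono
                        (≡.subst (ℕ._< Fin.toℕ j) (Fin.toℕ-inject₁ i) (ℕ.≰⇒> j≰i))))
    ... | j , z≈ with j Fin.≤? inject₁ i
    ... | yes j≤i = inj₁ (≤-trans (≤-reflexive z≈) (chain-mono j≤i))
    ... | no  j≰i = inj₂ (≤-trans (chain-mono
                      (≡.subst (ℕ._< Fin.toℕ j) (Fin.toℕ-inject₁ i) (ℕ.≰⇒> j≰i)))
                      (≤-reflexive (Eq.sym z≈)))

    series : CompositionSeries d (chain (Fin.fromℕ d))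
    series = compositionSeries chain bottom-zero step-mono covering

  -- Here `d ≥ 1` enters: the chain has two distinct members, whereas `1# ≤ 0#` would identify all
  -- elements.
  height-nontrivial : ∀ {d} .{{_ : NonZero d}} → HasHeight L d → ¬ 1# ≤ 0#
  height-nontrivial {suc d} (chain , isMax) 1≤0 =
    proj₂ (IsMaximalChain.strict isMax zero (suc zero) (ℕ.s≤s ℕ.z≤n))
      (antisym collapse collapse)
    where
    collapse : ∀ {x y} → x ≤ y
    collapse = ≤-trans (maximum _) (≤-trans 1≤0 (minimum _))

  module Rank (em : ∀ {ℓ} → ExcludedMiddle ℓ) where

    -- The height of `z` as a sum over the factors of the series. By the covering condition
    -- `(z ∧ y) ∨ x` is either `x` or `y`, so each factor contributes 0 or 1; excluded middle tells
    -- which.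
    rank : ∀ {n y} → CompositionSeries n y → Carrier → ℕ
    rank (bottom _) z = 0
    rank (cover {x = x} {y} s _ _) z with em {P = y ≤ (z ∧ y) ∨ x}
    ... | yes _ = suc (rank s z)
    ... | no  _ = rank s z

    rank≤length : ∀ {n y} (s : CompositionSeries n y) z → rank s z ℕ.≤ n
    rank≤length (bottom _) z = ℕ.z≤n
    rank≤length (cover {x = x} {y} s _ _) z with em {P = y ≤ (z ∧ y) ∨ x}
    ... | yes _ = ℕ.s≤s (rank≤length s z)
    ... | no  _ = ℕ.m≤n⇒m≤1+n (rank≤length s z)

    trace-mono : ∀ {x y z w} → z ≤ w → (z ∧ y) ∨ x ≤ (w ∧ y) ∨ x
    trace-mono z≤w = ∨-least
      (≤-trans (∧-greatest (≤-trans (x∧y≤x _ _) z≤w) (x∧y≤y _ _)) (x≤x∨y _ _)) (y≤x∨y _ _)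

    -- The elements `z ∧ y ≤ w ∧ y` have the same meet and the same join with `x`; cancelling `x`
    -- identifies them.
    trace-reflects : ∀ {x y z w} → x ≤ y → z ≤ w →
      w ∧ x ≤ z → w ∧ y ≤ (z ∧ y) ∨ x → w ∧ y ≤ z
    trace-reflects {x} {y} {z} {w} x≤y z≤w w∧x≤z w∧y≤ = ≤-trans (modular-cancel x
      (∧-greatest (≤-trans (x∧y≤x z y) z≤w) (x∧y≤y z y))
      (∧-greatest (≤-trans (∧-greatest (≤-trans (x∧y≤x _ x) (x∧y≤x w y)) (x∧y≤y _ x)) w∧x≤z)
                  (≤-trans (x∧y≤x _ x) (x∧y≤y w y)))
      w∧y≤) (x∧y≤x z y)

    rank-mono : ∀ {n y} (s : CompositionSeries n y) {z w} → z ≤ w → rank s z ℕ.≤ rank s w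
    rank-mono (bottom _) z≤w = ℕ.z≤n
    rank-mono (cover {x = x} {y} s _ _) {z} {w} z≤w
      with em {P = y ≤ (z ∧ y) ∨ x} | em {P = y ≤ (w ∧ y) ∨ x}
    ... | yes _ | yes _ = ℕ.s≤s (rank-mono s z≤w)
    ... | no  _ | yes _ = ℕ.m≤n⇒m≤1+n (rank-mono s z≤w)
    ... | no  _ | no  _ = rank-mono s z≤w
    ... | yes p | no ¬p = contradiction (≤-trans p (trace-mono z≤w)) ¬p

    -- Every factor filled by `z` is filled by `w`, so equal ranks mean that both fill the same
    -- factors; `trace-reflects` then lifts `w ∧ x ≤ z` through one factor at a time.
    rank-reflects : ∀ {n y} (s : CompositionSeries n y) {z w} →
      z ≤ w → rank s w ℕ.≤ rank s z → w ∧ y ≤ z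
    rank-reflects (bottom y≤0) z≤w _ = ≤-trans (x∧y≤y _ _) (≤-trans y≤0 (minimum _))
    rank-reflects (cover {x = x} {y} s x≤y cov) {z} {w} z≤w rw≤rz
      with em {P = y ≤ (z ∧ y) ∨ x} | em {P = y ≤ (w ∧ y) ∨ x}
    ... | no  _ | yes _ = contradiction (ℕ.≤-trans rw≤rz (rank-mono s z≤w)) (ℕ.<-irrefl refl)
    ... | yes p | no ¬p = contradiction (≤-trans p (trace-mono z≤w)) ¬p
    ... | yes p | yes _ = 
      trace-reflects x≤y z≤w (rank-reflects s z≤w (ℕ.≤-pred rw≤rz)) (≤-trans (x∧y≤y _ _) p)
    -- As `w` does not fill the factor, covering pushes its trace down to `x`, hence below that of
    -- `z`.
    ... | no _  | no ¬p with cov ((w ∧ y) ∨ x) (y≤x∨y _ _) (∨-least (x∧y≤y w y) x≤y)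
    ... | inj₁ q = trace-reflects x≤y z≤w (rank-reflects s z≤w rw≤rz)
                     (≤-trans (≤-trans (x≤x∨y _ x) q) (y≤x∨y _ x))
    ... | inj₂ q = contradiction q ¬p

    rank-strict : ∀ {n y} (s : CompositionSeries n y) → 1# ≤ y →
      ∀ {z w} → z ≤ w → ¬ w ≤ z → rank s z ℕ.< rank s w
    rank-strict s 1≤y z≤w w≰z = ℕ.≰⇒> λ rw≤rz → w≰z
      (≤-trans (∧-greatest ≤-refl (≤-trans (maximum _) 1≤y)) (rank-reflects s z≤w rw≤rz))

    module _ {d y} (s : CompositionSeries d y) (1≤y : 1# ≤ y) where

      -- Each member is nonzero and meets the join of the later ones in 0, so adding it raises the
      -- rank strictly.
      rank-join : ∀ {n} (a : Fin n → Carrier) → PairwiseOrthogonal a → AllNonZero a →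
        n ℕ.≤ rank s (⨆ a)
      rank-join {zero}  a orth nz = ℕ.z≤n
      rank-join {suc n} a orth nz = ℕ.≤-trans
        (ℕ.s≤s (rank-join (a ∘ suc) (tail-orthogonal orth) (nz ∘ suc)))
        (rank-strict s 1≤y (y≤x∨y _ _) λ p → nz zero
          (≤-trans (∧-greatest ≤-refl (≤-trans (x≤x∨y _ _) p)) (head-orthogonal orth)))

      -- A nonzero `z` strictly below `a i` splits the step that adds `a i` into two: first `z`,
      -- then the rest of `a i`. The second is strict by cancelling the join of the later members.
      rank-join-refined : ∀ {n} (a : Fin n → Carrier) → PairwiseOrthogonal a → AllNonZero a →
        ∀ i {z} → z ≤ a i → ¬ z ≤ 0# → ¬ a i ≤ z → suc n ℕ.≤ rank s (⨆ a)
      rank-join-refined {suc n} a orth nz zero {z} z≤a z≰0 a≰z = ℕ.≤-trans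
        (ℕ.s≤s (ℕ.≤-trans
          (ℕ.s≤s (rank-join (a ∘ suc) (tail-orthogonal orth) (nz ∘ suc)))
          (rank-strict s 1≤y (y≤x∨y z (⨆ (a ∘ suc))) λ p → z≰0
            (≤-trans (∧-greatest z≤a (≤-trans (x≤x∨y _ _) p)) (head-orthogonal orth)))))
        (rank-strict s 1≤y (∨-least (≤-trans z≤a (x≤x∨y _ _)) (y≤x∨y _ _)) λ p → a≰z
          (modular-cancel (⨆ (a ∘ suc)) z≤a (≤-trans (head-orthogonal orth) (minimum _))
            (≤-trans (x≤x∨y _ _) p)))
      rank-join-refined {suc n} a orth nz (suc i) z≤a z≰0 a≰z = ℕ.≤-trans
        (ℕ.s≤s (rank-join-refined (a ∘ suc) (tail-orthogonal orth) (nz ∘ suc) i z≤a z≰0 a≰z))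
        (rank-strict s 1≤y (y≤x∨y _ _) λ p → nz zero
          (≤-trans (∧-greatest ≤-refl (≤-trans (x≤x∨y _ _) p)) (head-orthogonal orth)))

      module _ (a : Fin d → Carrier) (orth : PairwiseOrthogonal a) (nz : AllNonZero a) where

        -- Were a member not an atom, or the join below not 1, some element would have rank at least
        -- `suc d` along a series of length `d`.
        full-family-atoms : ∀ i {z} → z ≤ a i → ¬ z ≤ 0# → a i ≤ z
        full-family-atoms i z≤a z≰0 = decidable-stable em λ a≰z → ℕ.<-irrefl refl
          (ℕ.≤-trans (rank-join-refined a orth nz i z≤a z≰0 a≰z) (rank≤length s _))

        full-family-total : 1# ≤ ⨆ a
        full-family-total = decidable-stable em λ 1≰ → ℕ.<-irrefl refl
          (ℕ.≤-trans (ℕ.s≤s (rank-join a orth nz))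
            (ℕ.≤-trans (rank-strict s 1≤y (maximum _) 1≰) (rank≤length s _)))

  -- Values of the terms h̃ and g̃

  module _ {v} {V : Set v} (ρ : V → Carrier) where
    private
      ⟦_⟧ : Term V → Carrier
      ⟦_⟧ = eval rawOrtholattice ρ

    eval-⋁-upper : ∀ {d is i} (t : Fin d → Term V) → i ∈ is → ⟦ t i ⟧ ≤ ⟦ ⋁ is t ⟧
    eval-⋁-upper t (here refl) = x≤x∨y _ _
    eval-⋁-upper t (there i∈)  = ≤-trans (eval-⋁-upper t i∈) (y≤x∨y _ _)

    eval-⋁-least : ∀ {d x} is (t : Fin d → Term V) → (∀ i → i ∈ is → ⟦ t i ⟧ ≤ x) → ⟦ ⋁ is t ⟧ ≤ x
    eval-⋁-least []       t p = minimum _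
    eval-⋁-least (i ∷ is) t p =
      ∨-least (p i (here refl)) (eval-⋁-least is t λ j j∈ → p j (there j∈))

    eval-⋀-lower : ∀ {d is i} (t : Fin d → Term V) → i ∈ is → ⟦ ⋀ is t ⟧ ≤ ⟦ t i ⟧
    eval-⋀-lower t (here refl) = x∧y≤x _ _
    eval-⋀-lower t (there i∈)  = ≤-trans (x∧y≤y _ _) (eval-⋀-lower t i∈)

    eval-⋀-greatest : ∀ {d x} is (t : Fin d → Term V) → (∀ i → i ∈ is → x ≤ ⟦ t i ⟧) → x ≤ ⟦ ⋀ is t ⟧
    eval-⋀-greatest []       t p = maximum _
    eval-⋀-greatest (i ∷ is) t p =
      ∧-greatest (p i (here refl)) (eval-⋀-greatest is t λ j j∈ → p j (there j∈))

    module _ {d} (y : Fin (suc d) → Term V) where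
      private
        Y : Fin (suc d) → Carrier
        Y i = ⟦ y i ⟧

        b : Fin d → Carrier
        b i = ⟦ isolated y i ⟧

        complementPair capped : Fin d → Term V
        complementPair i = (y zero ∨ₜ y (suc i)) ∧ₜ (¬ₜ y zero ∨ₜ ¬ₜ y (suc i))
        capped i         = y zero ∨ₜ isolated y i

        cappedBy : Term V → Fin d → Term V
        cappedBy x i = y zero ∨ₜ (x ∧ₜ y (suc i))

        hatPart : Term V → Fin d → Fin d → Term V
        hatPart x i j = (((x ∨ₜ ¬ₜ y (suc i)) ∧ₜ y (suc i)) ∨ₜ y zero) ∧ₜ y (suc j)

      isolated-lower : ∀ i → b i ≤ Y (suc i)
      isolated-lower i = x∧y≤x _ _

      isolated-orthogonal : ∀ i j → ¬ j ≡ i → b i ≤ ∼ Y (suc j)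
      isolated-orthogonal i j j≢i = ≤-trans (x∧y≤y _ _)
        (eval-⋀-lower (λ j → ¬ₜ y (suc j)) (∈-filter⁺ (λ j → ¬? (j Fin.≟ i)) (∈-allFin j) j≢i))

      isolated-greatest : ∀ i {x} → x ≤ Y (suc i) → (∀ j → ¬ j ≡ i → x ≤ ∼ Y (suc j)) → x ≤ b i
      isolated-greatest i p q = ∧-greatest p (eval-⋀-greatest (_≠-indices {V = V} i) (λ j → ¬ₜ y (suc j))
        λ j j∈ → q j (proj₂ (∈-filter⁻ (λ j → ¬? (j Fin.≟ i)) {xs = allFin d} j∈)))

      -- The negated variables in `isolated` force orthogonality for arbitrary values of ȳ:
      -- `b i ≤ ∼ Y (suc j) ≤ ∼ b j`.
      isolated-pairwise : PairwiseOrthogonal b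
      isolated-pairwise i j i≢j =
        ≤-trans (isolated-orthogonal i j (i≢j ∘ ≡.sym)) (∼-antitone (isolated-lower j))

      -- All `b j` with `j ≠ i` lie below `∼ Y (suc i)`, so `b i` already has join 1 with it;
      -- cancelling `∼ Y (suc i)` leaves no room between `b i` and `Y (suc i)`.
      isolated-total : 1# ≤ ⨆ b → ∀ i → Y (suc i) ≤ b i
      isolated-total 1≤⨆b i = modular-cancel (∼ Y (suc i)) (isolated-lower i)
        (≤-trans (≤-reflexive (∧-complement _)) (minimum _))
        (≤-trans (maximum _) (≤-trans 1≤⨆b (⨆-least b below)))
        where
        below : ∀ j → b j ≤ b i ∨ ∼ Y (suc i)
        below j with i Fin.≟ j
        ... | yes refl = x≤x∨y _ _
        ... | no  i≢j  = ≤-trans (isolated-orthogonal j i i≢j) (y≤x∨y _ _)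

      -- If x were 0, its Sasaki projections would vanish and ĥ would shrink to the join of the
      -- `Y zero ∧ Y (suc j)`. Value 1 of h makes these 0, by the conjuncts that join the two
      -- negations.
      h-tilde⇒nonzero : ¬ 1# ≤ 0# → ∀ x → 1# ≤ ⟦ h-tilde x y ⟧ → ¬ ⟦ x ⟧ ≤ 0#
      h-tilde⇒nonzero 1≰0 x 1≤h̃ x≤0 = 1≰0 (≤-trans 1≤h̃ (≤-trans (x∧y≤y _ _) hat≤0))
        where
        Y₀∧Y≤0 : ∀ i → Y zero ∧ Y (suc i) ≤ 0#
        Y₀∧Y≤0 i = ≤-trans (∼-swap (∨-least (∼-antitone (x∧y≤x _ _)) (∼-antitone (x∧y≤y _ _))))
          (≤-trans (∼-antitone (≤-trans 1≤h̃ (≤-trans (x∧y≤x _ _) (≤-trans (x∧y≤y _ _)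
            (≤-trans (eval-⋀-lower complementPair (∈-allFin i)) (x∧y≤y _ _)))))) ∼1≤0)

        hat≤0 : ⟦ h-hat x y ⟧ ≤ 0#
        hat≤0 = eval-⋁-least (allFin d) (λ i → ⋁ (allFin d) (hatPart x i)) λ i _ → eval-⋁-least (allFin d) (hatPart x i) λ j _ → ≤-trans
          (∧-greatest (≤-trans (x∧y≤x _ _) (∨-least (≤-trans (≤-trans
              (∧-greatest (≤-trans (x∧y≤x _ _) (∨-least (≤-trans x≤0 (minimum _)) ≤-refl)) (x∧y≤y _ _))
              (≤-trans (disjoint ≤-refl) (minimum _))) ≤-refl) ≤-refl))
            (x∧y≤y _ _))
          (Y₀∧Y≤0 j)

      module _ (em : ∀ {ℓ} → ExcludedMiddle ℓ) {top} (s : CompositionSeries d top) (1≤top : 1# ≤ top) where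
        open Rank em

        g-tilde⇒one : ∀ x → ¬ ⟦ g-tilde x y ⟧ ≤ 0# → 1# ≤ ⟦ x ⟧
        g-tilde⇒one x g̃≰0 = ≤-trans total (⨆-least b λ i →
            ≤-trans (isolated-lower i) (≤-trans (Y≤X∧Y i) (x∧y≤x _ _)))
          where
          G = ⟦ g-tilde x y ⟧

          -- `G` lies below `∼ Y zero`; if `z` were 0, it would lie below `Y zero` as well. So
          -- whatever a conjunct of g̃ joins to `Y zero` is nonzero.
          vanish : ∀ {z} → G ≤ Y zero ∨ z → ¬ z ≤ 0#
          vanish p z≤0 = g̃≰0 (≤-trans
            (∧-greatest (≤-trans p (∨-disjunctive z≤0)) (≤-trans (x∧y≤x _ _) (x∧y≤x _ _)))
            (≤-reflexive (∧-complement _)))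

          b-nonzero : AllNonZero b
          b-nonzero i = vanish (≤-trans (x∧y≤x _ _) (≤-trans (x∧y≤y _ _)
            (eval-⋀-lower capped (∈-allFin i))))

          total : 1# ≤ ⨆ b
          total = full-family-total s 1≤top b isolated-pairwise b-nonzero

          Y≤X∧Y : ∀ i → Y (suc i) ≤ ⟦ x ⟧ ∧ Y (suc i)
          Y≤X∧Y i = ≤-trans (isolated-total total i) (full-family-atoms s 1≤top b isolated-pairwise b-nonzero i
            (≤-trans (x∧y≤y _ _) (isolated-total total i))
            (vanish (≤-trans (x∧y≤y _ _) (eval-⋀-lower (cappedBy x) (∈-allFin i)))))

      module _ (1≰0 : ¬ 1# ≤ 0#) (diamond : IsOrthogonalDiamond L d Y) where
        open IsOrthogonalDiamond diamond

        1≤⨆Y : 1# ≤ ⨆ (Y ∘ suc)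
        1≤⨆Y = ≤-reflexive (Eq.sym join)

        -- `Y zero` is the common complement of the other members, the axis of the perspectivities
        -- between them. If it were 1, all of them would be 0 and could not join to 1.
        axis-proper : ¬ 1# ≤ Y zero
        axis-proper 1≤Y₀ = 1≰0 (≤-trans 1≤⨆Y (⨆-least (Y ∘ suc) λ i →
          ≤-trans (∧-greatest (≤-trans (maximum _) 1≤Y₀) ≤-refl) (≤-reflexive (meet₀ i))))

        Y-nonzero : AllNonZero (Y ∘ suc)
        Y-nonzero i Y≤0 = axis-proper (≤-trans (≤-reflexive (Eq.sym (join₀ i))) (∨-disjunctive Y≤0))

        Y≤b : ∀ i → Y (suc i) ≤ b i
        Y≤b i = isolated-greatest i ≤-refl λ j j≢i → orthogonal i j (j≢i ∘ ≡.sym)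

        -- At the diamond each conjunct that contains `Y zero` as a joinand is at least
        -- `Y zero ∨ Y (suc i)`, which is 1; hence g̃ is at least `∼ Y zero`, and this is nonzero
        -- because the axis is proper.
        one⇒g-tilde : ∀ x → 1# ≤ ⟦ x ⟧ → ¬ ⟦ g-tilde x y ⟧ ≤ 0#
        one⇒g-tilde x 1≤x g̃≤0 = axis-proper
          (≤-trans (x∨∼x (Y zero)) (∨-disjunctive (≤-trans ∼Y₀≤g̃ g̃≤0)))
          where
          one : ∀ i {z} → Y (suc i) ≤ z → ∼ Y zero ≤ Y zero ∨ z
          one i p = ≤-trans (maximum _) (≤-trans (≤-reflexive (Eq.sym (join₀ i)))
            (∨-least (x≤x∨y _ _) (≤-trans p (y≤x∨y _ _))))

          ∼Y₀≤g̃ : ∼ Y zero ≤ ⟦ g-tilde x y ⟧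
          ∼Y₀≤g̃ = ∧-greatest
            (∧-greatest ≤-refl (eval-⋀-greatest (allFin d) capped λ i _ → one i (Y≤b i)))
            (eval-⋀-greatest (allFin d) (cappedBy x) λ i _ → one i (∧-greatest (≤-trans (maximum _) 1≤x) ≤-refl))

        module _ (em : ∀ {ℓ} → ExcludedMiddle ℓ) {top} (s : CompositionSeries d top) (1≤top : 1# ≤ top) where
          open Rank em

          nonzero⇒h-tilde : ∀ x → ¬ ⟦ x ⟧ ≤ 0# → 1# ≤ ⟦ h-tilde x y ⟧
          nonzero⇒h-tilde x x≰0 = ∧-greatest (∧-greatest 1≤⋁b 1≤⋀) 1≤hat
            where
            X = ⟦ x ⟧

            1≤⋁b : 1# ≤ ⟦ ⋁ (allFin d) (isolated y) ⟧
            1≤⋁b = ≤-trans 1≤⨆Y (⨆-least (Y ∘ suc) λ i →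
              ≤-trans (Y≤b i) (eval-⋁-upper (isolated y) (∈-allFin i)))

            1≤⋀ : 1# ≤ ⟦ ⋀ (allFin d) complementPair ⟧
            1≤⋀ = eval-⋀-greatest (allFin d) complementPair λ i _ → ∧-greatest
              (≤-reflexive (Eq.sym (join₀ i)))
              (≤-trans (∼-swap (≤-trans (≤-reflexive (meet₀ i)) (minimum _))) (∼-∧ _ _))

            -- If all Sasaki projections of `X` vanished, every `Y (suc i)` would lie below `∼ X`,
            -- and so would their join 1.
            touched : ∃[ i ] ¬ (X ∨ ∼ Y (suc i)) ∧ Y (suc i) ≤ 0#
            touched = decidable-stable em λ none → x≰0 (≤-trans
              (∼-swap (≤-trans 1≤⨆Y (⨆-least (Y ∘ suc) λ i →
                ∼-swap (sasaki-zero (decidable-stable em λ p≰0 → none (i , p≰0)))))) ∼1≤0)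

            -- For this `i` the projection is the whole atom `Y (suc i)`, so its join with `Y zero`
            -- is 1; row `i` of ĥ is then the join of all `Y (suc j)`.
            1≤hat : 1# ≤ ⟦ h-hat x y ⟧
            1≤hat with touched
            ... | i , p≰0 = ≤-trans 1≤⨆Y (⨆-least (Y ∘ suc) λ j → ≤-trans
              (∧-greatest (≤-trans (maximum _) (≤-trans (≤-reflexive (Eq.sym (join₀ i)))
                (∨-least (y≤x∨y _ _) (≤-trans Yᵢ≤p (x≤x∨y _ _))))) ≤-refl)
              (≤-trans (eval-⋁-upper (hatPart x i) (∈-allFin j))
                (eval-⋁-upper (λ i → ⋁ (allFin d) (hatPart x i)) (∈-allFin i))))
              where
              Yᵢ≤p : Y (suc i) ≤ (X ∨ ∼ Y (suc i)) ∧ Y (suc i)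
              Yᵢ≤p = full-family-atoms s 1≤top (Y ∘ suc) orthogonal Y-nonzero i (x∧y≤y _ _) p≰0

-- Subspaces of a unitary space

opaque
  conj-zero : ∀ {z} → z ≈ℂ 0ℂ → conj z ≈ℂ 0ℂ
  conj-zero (p , q) = p , trans (-‿cong q) -0#≈0#
    where
    open CommutativeRing ℝ-commutativeRing
    open RingProperties ring

module Unitary (em : ∀ {ℓ} → ExcludedMiddle ℓ) {f m ℓm} {F : StarSubfield f} (H : UnitarySpace F m ℓm) where
  private module F = StarSubfield F
  open UnitarySpace H
  open Sum +ᴹ-commutativeMonoid using (sum)
  open module Subspaces (U : Subspace H) = Subspace U

  infix 4 _⟂_
  _⟂_ : Carrierᴹ → Carrierᴹ → Set
  x ⟂ y = ⟨ x ∣ y ⟩ F.≈ F.0#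

  opaque
    ⟂-sym : ∀ {x y} → x ⟂ y → y ⟂ x
    ⟂-sym {x} {y} p = F.trans (hermitian x y) (StarSubfield.equalF (conj-zero (StarSubfield.underlying p)))

    ⟂-resp : ∀ {x y z} → y ≈ᴹ z → x ⟂ y → x ⟂ z
    ⟂-resp y≈z = F.trans (⟨∣⟩-cong ≈ᴹ-refl (≈ᴹ-sym y≈z))

    ⟂-+ : ∀ {x y z} → x ⟂ y → x ⟂ z → x ⟂ y +ᴹ z
    ⟂-+ p q = F.trans (additive _ _ _) (F.trans (F.+-cong p q) (F.+-identityˡ F.0#))

    ⟂-* : ∀ {x y} a → x ⟂ y → x ⟂ a *ₗ y
    ⟂-* a p = F.trans (homogeneous a _ _) (F.trans (F.*-cong F.refl p) (F.zeroʳ a))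

    ⟂-0 : ∀ {x} → x ⟂ 0ᴹ
    ⟂-0 {x} = ⟂-resp (*ₗ-zeroˡ 0ᴹ) (F.trans (homogeneous F.0# x 0ᴹ) (F.zeroˡ _))

    ⟂-cancelʳ : ∀ {x y z} → x ⟂ y +ᴹ z → x ⟂ z → x ⟂ y
    ⟂-cancelʳ {x} {y} {z} p q = F.trans (F.sym (F.+-identityʳ _))
      (F.trans (F.+-cong F.refl (F.sym q)) (F.trans (F.sym (additive x y z)) p))

  opaque
    isotropic⇒0 : ∀ {x} → x ⟂ x → x ≈ᴹ 0ᴹ
    isotropic⇒0 {x} p = decidable-stable em λ x≉0 → anisotropic x x≉0 p

  opaque
    -- The elimination step behind all that follows, with `a` equal to -⟨w∣x⟩/⟨w∣e⟩. For `w` equal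
    -- to `e` it is the Gram-Schmidt step; otherwise it moves `x` along `e` into the hyperplane
    -- orthogonal to `w`.
    clear : ∀ w x e → ¬ w ⟂ e → ∃[ a ] w ⟂ x +ᴹ a *ₗ e
    clear w x e w⟂̸e with F.inv-closed (proj₂ ⟨ w ∣ e ⟩) (w⟂̸e ∘ StarSubfield.equalF)
    ... | i , i∈ , e*i≈1 = a , F.trans (additive w x (a *ₗ e))
            (F.trans (F.+-cong F.refl (F.trans (homogeneous a w e) a*e)) (F.-‿inverseʳ _))
      where
      i′ : F.Carrier
      i′ = i , i∈
      a : F.Carrier
      a = F.- ⟨ w ∣ x ⟩ F.* i′

      a*e : a F.* ⟨ w ∣ e ⟩ F.≈ F.- ⟨ w ∣ x ⟩
      a*e = F.trans (F.*-assoc _ i′ _) (F.trans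
        (F.*-cong F.refl (F.trans (F.*-comm i′ ⟨ w ∣ e ⟩) (StarSubfield.equalF e*i≈1)))
        (F.*-identityʳ _))

  -- `project x` is minus the orthogonal projection of x onto the span of the axes.
  record Frame (n : ℕ) : Set (f ⊔ m ⊔ ℓm) where
    field
      axis       : Fin n → Carrierᴹ
      orthogonal : ∀ i j → ¬ i ≡ j → axis i ⟂ axis j
      nonzero    : ∀ i → ¬ axis i ⟂ axis i
      diagonal   : Carrierᴹ
      oblique    : ∀ i → ¬ axis i ⟂ diagonal
      inside     : ∀ {w} → (∀ i → axis i ⟂ w) → w ⟂ diagonal
      project    : ∀ x → ∃[ p ] (∀ i → axis i ⟂ x +ᴹ p) × (∀ {w} → (∀ i → axis i ⟂ w) → w ⟂ p)

  open Frame

  emptyFrame : Frame 0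
  emptyFrame = record
    { axis = λ () ; orthogonal = λ () ; nonzero = λ () ; diagonal = 0ᴹ ; oblique = λ ()
    ; inside = λ _ → ⟂-0 ; project = λ x → 0ᴹ , (λ ()) , λ _ → ⟂-0 }

  -- A vector counts as lying in the span of the axes if it is orthogonal to all `w` that are
  -- orthogonal to the axes. The diagonal is the sum of the axes, so its product with an axis is
  -- that axis's own nonzero square.
  extendFrame : ∀ {n} (φ : Frame n) e → (∀ i → axis φ i ⟂ e) → ¬ e ⟂ e → Frame (suc n)
  extendFrame φ e φ⟂e e⟂̸e = record
    { axis       = extended
    ; orthogonal = λ { zero    zero    0≢0 → contradiction refl 0≢0
                     ; zero    (suc j) _   → ⟂-sym (φ⟂e j)
                     ; (suc i) zero    _   → φ⟂e i
                     ; (suc i) (suc j) i≢j → orthogonal φ i j (i≢j ∘ ≡.cong suc) }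
    ; nonzero    = λ { zero → e⟂̸e ; (suc i) → nonzero φ i }
    ; diagonal   = e +ᴹ diagonal φ
    ; oblique    = λ { zero    p → e⟂̸e (⟂-cancelʳ p (inside φ φ⟂e))
                     ; (suc i) p → oblique φ i
                         (⟂-cancelʳ (⟂-resp (+ᴹ-comm e (diagonal φ)) p) (φ⟂e i)) }
    ; inside     = λ ⟂w → ⟂-+ (⟂-sym (⟂w zero)) (inside φ (⟂w ∘ suc))
    ; project    = project′ }
    where
    extended : Fin _ → Carrierᴹ
    extended zero    = e
    extended (suc i) = axis φ i

    project′ : ∀ x → ∃[ p ] (∀ i → extended i ⟂ x +ᴹ p) × (∀ {w} → (∀ i → extended i ⟂ w) → w ⟂ p)
    project′ x with project φ x
    ... | p , φ⟂x+p , p-inside with clear e (x +ᴹ p) e e⟂̸e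
    ... | a , e⟂ = p +ᴹ a *ₗ e
      , (λ { zero    → ⟂-resp (+ᴹ-assoc x p _) e⟂
           ; (suc i) → ⟂-resp (+ᴹ-assoc x p _) (⟂-+ (φ⟂x+p i) (⟂-* a (φ⟂e i))) })
      , λ {w} ⟂w → ⟂-+ {w} (p-inside (⟂w ∘ suc)) (⟂-* a (⟂-sym (⟂w zero)))

  -- A residual either becomes a new axis or is isotropic, hence 0, and then its vector already lies
  -- in the span; `k` is the number of axes that result.
  gramSchmidt : ∀ {n} (b : Fin n → Carrierᴹ) →
    ∃[ k ] ∃ λ (φ : Frame k) → ∀ {w} → (∀ i → axis φ i ⟂ w) → ∀ j → w ⟂ b j
  gramSchmidt {zero}  b = 0 , emptyFrame , λ _ ()
  gramSchmidt {suc n} b with gramSchmidt (b ∘ suc)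
  ... | k , φ , spans with project φ (b zero)
  ... | p , φ⟂e , p-inside with em {P = b zero +ᴹ p ⟂ b zero +ᴹ p}
  ... | yes e⟂e = k , φ , λ ⟂w → λ
          { zero    → ⟂-cancelʳ (⟂-resp (≈ᴹ-sym (isotropic⇒0 e⟂e)) ⟂-0) (p-inside ⟂w)
          ; (suc j) → spans ⟂w j }
  ... | no e⟂̸e = suc k , extendFrame φ (b zero +ᴹ p) φ⟂e e⟂̸e , λ ⟂w → λ
          { zero    → ⟂-cancelʳ (⟂-sym (⟂w zero)) (p-inside (⟂w ∘ suc))
          ; (suc j) → spans (⟂w ∘ suc) j }

  opaque
    ⟂-sum : ∀ {n w} (λs : Fin n → F.Carrier) (b : Fin n → Carrierᴹ) → (∀ i → w ⟂ b i) →
      w ⟂ sum (λ i → λs i *ₗ b i)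
    ⟂-sum {zero}  λs b p = ⟂-0
    ⟂-sum {suc n} λs b p = ⟂-+ (⟂-* (λs zero) (p zero)) (⟂-sum (λs ∘ suc) (b ∘ suc) (p ∘ suc))

  Complete : ∀ {n} → Frame n → Set _
  Complete φ = ∀ {w} → (∀ i → axis φ i ⟂ w) → w ≈ᴹ 0ᴹ

  orthogonalFrame : FiniteDimensional H → ∃[ k ] ∃ λ (φ : Frame k) → Complete φ
  orthogonalFrame (n , b , isBasis) with gramSchmidt b
  ... | k , φ , spans = k , φ , λ {w} ⟂w → isotropic⇒0
    (⟂-resp (≈ᴹ-sym (proj₂ (spanning w))) (⟂-sum (proj₁ (spanning w)) b (spans ⟂w)))
    where open IsBasis isBasis

  opaque
    -1*ₗ : ∀ x → (F.- F.1#) *ₗ x +ᴹ x ≈ᴹ 0ᴹ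
    -1*ₗ x = ≈ᴹ-trans (+ᴹ-cong ≈ᴹ-refl (≈ᴹ-sym (*ₗ-identityˡ x)))
      (≈ᴹ-trans (≈ᴹ-sym (*ₗ-distribʳ x _ _)) (≈ᴹ-trans (*ₗ-cong (F.-‿inverseˡ F.1#) ≈ᴹ-refl) (*ₗ-zeroˡ x)))

  opaque
    cancel-term : ∀ x y → y ≈ᴹ (F.- F.1#) *ₗ x +ᴹ (x +ᴹ y)
    cancel-term x y = ≈ᴹ-sym (≈ᴹ-trans (≈ᴹ-sym (+ᴹ-assoc _ x y))
      (≈ᴹ-trans (+ᴹ-cong (-1*ₗ x) ≈ᴹ-refl) (+ᴹ-identityˡ y)))

  opaque
    subtract : ∀ U {x y} → Member U x → Member U (x +ᴹ y) → Member U y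
    subtract U {x} {y} p q = resp U (≈ᴹ-sym (cancel-term x y)) (+-closed U (*ₗ-closed U _ p) q)

  join-difference : ∀ U W {x p} → Member U p → Member W (x +ᴹ p) → Member (_+ₛ_ H U W) x
  join-difference U W {x} {p} p∈ q∈ = _ , _ , *ₗ-closed U _ p∈ , resp W (+ᴹ-comm x p) q∈ , cancel-term p x

  -- The lattice of subspaces

  private
    Sub : Set _
    Sub = Subspace H

    infix 4 _⊑_
    _⊑_ : Sub → Sub → Set _
    U ⊑ W = ∀ {x} → Member U x → Member W x

    perp : Sub → Sub
    perp = _⊥ H

    sum-space meet-space : Sub → Sub → Sub
    sum-space  = _+ₛ_ H
    meet-space = _∩ₛ_ H

  -- Subspaces are given by equations: a span quantifies over scalars and so lives in a larger universe.
  annihilator : ∀ {I : Set} → (I → Carrierᴹ) → Sub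
  annihilator u = record
    { Member    = λ x → ∀ i → Lift (m ⊔ ℓm) (u i ⟂ x)
    ; resp      = λ e p i → lift (⟂-resp e (lower (p i)))
    ; 0-closed  = λ _ → lift ⟂-0
    ; +-closed  = λ p q i → lift (⟂-+ (lower (p i)) (lower (q i)))
    ; *ₗ-closed = λ a p i → lift (⟂-* a (lower (p i)))
    }

  module _ {n} (φ : Frame n) (complete : Complete φ) where
    private
      v : Fin n → Carrierᴹ
      v = axis φ

    -- The span of the first `k` axes, given as the orthocomplement of the remaining ones.
    flag : Fin (suc n) → Sub
    flag k = annihilator {∃[ j ] Fin.toℕ k ℕ.≤ Fin.toℕ j} (v ∘ proj₁)

    flag-mono : ∀ i → flag (inject₁ i) ⊑ flag (suc i)
    flag-mono i p (j , i<j) = p (j , ℕ.≤-trans (ℕ.≤-reflexive (Fin.toℕ-inject₁ i)) (ℕ.<⇒≤ i<j))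

    flag-step : ∀ i {x} → Member (flag (suc i)) x → v i ⟂ x → Member (flag (inject₁ i)) x
    flag-step i p vᵢ⟂x (j , i≤j) with i Fin.≟ j
    ... | yes refl = lift vᵢ⟂x
    ... | no  i≢j  = p (j , ℕ.≤∧≢⇒< (ℕ.≤-trans (ℕ.≤-reflexive (≡.sym (Fin.toℕ-inject₁ i))) i≤j)
                              (i≢j ∘ Fin.toℕ-injective))

    -- On `flag (suc i)` the product with `v i` is a linear form with kernel `flag (inject₁ i)`: one
    -- vector outside the kernel moves all others into it.
    flag-clear : ∀ i {x y} → Member (flag (suc i)) x → Member (flag (suc i)) y → ¬ v i ⟂ y →
      ∃[ a ] Member (flag (inject₁ i)) (x +ᴹ a *ₗ y)
    flag-clear i {x} {y} p q vᵢ⟂̸y with clear (v i) x y vᵢ⟂̸y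
    ... | a , vᵢ⟂ = a , flag-step i
      (+-closed (flag (suc i)) {x} p (*ₗ-closed (flag (suc i)) a {y} q)) vᵢ⟂

    flag-bottom : ∀ {x} → Member (flag zero) x → x ≈ᴹ 0ᴹ
    flag-bottom p = complete λ i → lower (p (i , ℕ.z≤n))

    flag-top : ∀ {x} → Member (flag (Fin.fromℕ n)) x
    flag-top (j , n≤j) = contradiction (Fin.toℕ<n j)
      (ℕ.≤⇒≯ (ℕ.≤-trans (ℕ.≤-reflexive (≡.sym (Fin.toℕ-fromℕ n))) n≤j))

    Splits : Sub → Set _
    Splits W = ∀ y → ∃[ p ] Member W p × Member (perp W) (y +ᴹ p)

    splits-resp : ∀ {U W} → U ⊑ W → W ⊑ U → Splits U → Splits W
    splits-resp U⊑W W⊑U s y with s y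
    ... | p , p∈ , y+p∈ = p , U⊑W p∈ , λ w w∈ → y+p∈ w (W⊑U w∈)

    -- The part of `W` in the flag gains at most one dimension per step. If excluded middle finds a
    -- new vector `x`, its residual `e` extends the projection as in Gram-Schmidt.
    splits-flag : ∀ W i → Splits (meet-space W (flag i))
    splits-flag W = <-weakInduction (λ i → Splits (meet-space W (flag i))) base step
      where
      base : Splits (meet-space W (flag zero))
      base y = 0ᴹ , 0-closed (meet-space W (flag zero)) , λ w (_ , w∈) →
        lift (⟂-sym (⟂-resp (≈ᴹ-sym (flag-bottom w∈)) ⟂-0))

      step : ∀ i → Splits (meet-space W (flag (inject₁ i))) → Splits (meet-space W (flag (suc i)))
      step i s with em {P = ∃[ x ] Member (meet-space W (flag (suc i))) x × ¬ v i ⟂ x}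
      ... | no none = splits-resp {meet-space W (flag (inject₁ i))} {meet-space W (flag (suc i))}
          (λ {x} (x∈W , x∈) → x∈W , flag-mono i {x} x∈)
          (λ {x} (x∈W , x∈) → x∈W , flag-step i x∈ (decidable-stable em λ ¬p → none (x , (x∈W , x∈) , ¬p)))
          s
      ... | yes (x , x∈@(x∈W , x∈flag) , vᵢ⟂̸x) with s x
      ... | q , q∈ , e⟂ = split
        where
        A B : Sub
        A = meet-space W (flag (inject₁ i))
        B = meet-space W (flag (suc i))

        A⊑B : A ⊑ B
        A⊑B {u} (u∈W , u∈) = u∈W , flag-mono i {u} u∈

        e : Carrierᴹ
        e = x +ᴹ q

        e∈B : Member B e
        e∈B = +-closed B {x} {q} x∈ (A⊑B q∈)

        -- Otherwise `e` is 0 and `x` is the negative of `q`, which lies in the smaller flag member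
        -- and is thus orthogonal to `v i`.
        e-anisotropic : ¬ e ⟂ e
        e-anisotropic e⟂e = vᵢ⟂̸x (⟂-cancelʳ (⟂-resp (≈ᴹ-sym (isotropic⇒0 e⟂e)) ⟂-0)
          (lower (proj₂ q∈ (i , ℕ.≤-reflexive (Fin.toℕ-inject₁ i)))))

        split : Splits B
        split y with s y
        ... | p , p∈ , y+p⟂ with clear e (y +ᴹ p) e e-anisotropic
        ... | a , e⟂z = p +ᴹ a *ₗ e
          , +-closed B {p} (A⊑B p∈) (*ₗ-closed B a {e} e∈B)
          , λ w w∈ → lift (⟂-sym (w⟂z w w∈))
          where
          z : Carrierᴹ
          z = y +ᴹ (p +ᴹ a *ₗ e)

          z⟂A : ∀ {u} → Member A u → z ⟂ u
          z⟂A u∈ = ⟂-sym (⟂-resp (+ᴹ-assoc y p _) (⟂-+ (lower (y+p⟂ _ u∈)) (⟂-* a (lower (e⟂ _ u∈)))))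

          z⟂x : z ⟂ x
          z⟂x = ⟂-cancelʳ (⟂-sym (⟂-resp (+ᴹ-assoc y p _) e⟂z)) (z⟂A q∈)

          -- Modulo `A` every element of `B` is a multiple of `x`, and `z` is orthogonal to `A` and
          -- to `x`.
          w⟂z : ∀ w → Member B w → z ⟂ w
          w⟂z w (w∈W , w∈) with flag-clear i {w} {x} w∈ x∈flag vᵢ⟂̸x
          ... | c , w+cx∈ = ⟂-cancelʳ
            (z⟂A (+-closed W w∈W (*ₗ-closed W c x∈W) , w+cx∈)) (⟂-* c z⟂x)

    splits : ∀ W → Splits W
    splits W = splits-resp {meet-space W (flag (Fin.fromℕ n))} {W} proj₁ (λ {x} p → p , flag-top {x})
      (splits-flag W (Fin.fromℕ n))

    -- The operations are literally those of `subspaceOrtholattice H`, so results about this lattice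
    -- apply to it without transport. Finite dimension enters through `splits`, for the involution
    -- and for joins with the complement.
    subspaces : ModularOrtholattice _ _ _
    subspaces = record
      { boundedLattice = record
        { Carrier = Sub
        ; _≈_ = RawOrtholattice._≈_ (subspaceOrtholattice H)
        ; _≤_ = _⊑_
        ; _∨_ = sum-space ; _∧_ = meet-space ; ⊤ = Hₛ H ; ⊥ = 0ₛ H
        ; isBoundedLattice = record
          { isLattice = record
            { isPartialOrder = record
              { isPreorder = record
                { isEquivalence = record
                  { refl  = id , id
                  ; sym   = λ (p , q) → q , p
                  ; trans = λ (p , q) (p′ , q′) → p′ ∘ p , q ∘ q′ }
                ; reflexive = λ (p , _) → p
                ; trans = λ p q → q ∘ p }
              ; antisym = λ p q → p , q }
            ; supremum = λ U W →
                (λ {x} p → x , 0ᴹ , p , 0-closed W , ≈ᴹ-sym (+ᴹ-identityʳ x))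
              , (λ {x} p → 0ᴹ , x , 0-closed U , p , ≈ᴹ-sym (+ᴹ-identityˡ x))
              , λ Z p q (u , w , u∈ , w∈ , x≈) → resp Z (≈ᴹ-sym x≈) (+-closed Z (p u∈) (q w∈))
            ; infimum = λ U W → proj₁ , proj₂ , λ Z p q z∈ → p z∈ , q z∈ }
          ; maximum = λ _ _ → _
          ; minimum = λ U (lift p) → resp U (≈ᴹ-sym p) (0-closed U) } }
      ; modular = λ U V W U⊑W →
            (λ (u , w , u∈ , (w∈V , w∈W) , x≈) →
              (u , w , u∈ , w∈V , x≈) , resp W (≈ᴹ-sym x≈) (+-closed W (U⊑W u∈) w∈W))
          , (λ ((u , w , u∈ , w∈ , x≈) , x∈) →
              u , w , u∈ , (w∈ , subtract W (U⊑W u∈) (resp W x≈ x∈)) , x≈)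
      ; ∼_ = perp
      ; ∼-antitone = λ U⊑W p w w∈ → p w (U⊑W w∈)
      ; ∼-involutive = λ W → double W , λ {x} x∈ w w∈ → lift (⟂-sym (lower (w∈ x x∈)))
      ; ∧-complement = λ W →
            (λ {x} (x∈ , x⟂) → lift (isotropic⇒0 (lower (x⟂ x x∈))))
          , (λ (lift p) → resp (meet-space W (perp W)) (≈ᴹ-sym p) (0-closed (meet-space W (perp W))))
      ; ∨-complement = λ W → _ , λ {x} _ → let p , p∈ , q∈ = splits W x in join-difference W (perp W) p∈ q∈
      }
      where
      double : ∀ W → perp (perp W) ⊑ W
      -- `x +ᴹ p` lies in the orthocomplement of `W` and is orthogonal to both `x` and `p`, hence to
      -- itself; so it is 0, and `x` lies in `W` together with `p`.
      double W {x} x∈ with splits W x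
      ... | p , p∈ , e∈ = subtract W p∈ (resp W (≈ᴹ-sym (≈ᴹ-trans (+ᴹ-comm p x) (isotropic⇒0
        (⟂-+ (lower (x∈ _ e∈)) (⟂-sym (lower (e∈ p p∈))))))) (0-closed W))

    open OrtholatticeProperties subspaces

    flag-series : CompositionSeries n (flag (Fin.fromℕ n))
    flag-series = compositionSeries flag (λ {x} p → lift (flag-bottom p)) (λ i {x} → flag-mono i {x}) covering
      where
      covering : ∀ i W → flag (inject₁ i) ⊑ W → W ⊑ flag (suc i) →
        W ⊑ flag (inject₁ i) ⊎ flag (suc i) ⊑ W
      covering i W lo hi with em {P = ∃[ x ] Member W x × ¬ v i ⟂ x}
      ... | no none = inj₁ λ {x} x∈ → flag-step i (hi x∈) (decidable-stable em λ ¬p → none (x , x∈ , ¬p))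
      ... | yes (x , x∈ , vᵢ⟂̸x) = inj₂ λ {w} w∈ →
        let a , w+ax∈ = flag-clear i {w} {x} w∈ (hi x∈) vᵢ⟂̸x
        in subtract W (*ₗ-closed W a x∈) (resp W (+ᴹ-comm w _) (lo w+ax∈))

    diamond : Fin (suc n) → Sub
    diamond zero    = annihilator {⊤} (λ _ → diagonal φ)
    diamond (suc i) = annihilator {∃[ j ] ¬ i ≡ j} (v ∘ proj₁)

    axis∈ : ∀ i → Member (diamond (suc i)) (v i)
    axis∈ i (j , i≢j) = lift (orthogonal φ j i (i≢j ∘ ≡.sym))

    vanishes : ∀ i {x} → Member (diamond (suc i)) x → v i ⟂ x → x ≈ᴹ 0ᴹ
    vanishes i p vᵢ⟂x = complete λ j → at j
      where
      at : ∀ j → _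
      at j with i Fin.≟ j
      ... | yes refl = vᵢ⟂x
      ... | no  i≢j  = lower (p (j , i≢j))

    on-line : ∀ i {x w} → Member (diamond (suc i)) x → w ⟂ v i → w ⟂ x
    on-line i {x} x∈ w⟂v with clear (v i) x (v i) (nonzero φ i)
    ... | a , v⟂ = ⟂-cancelʳ
      (⟂-resp (≈ᴹ-sym (vanishes i (+-closed D {x} x∈ (*ₗ-closed D a {v i} (axis∈ i))) v⟂)) ⟂-0) (⟂-* a w⟂v)
      where D = diamond (suc i)

    isDiamond : IsOrthogonalDiamond subspaces n diamond
    isDiamond = record
      { join       = _ , 1⊑⨆
      ; orthogonal = λ i j i≢j {x} x∈ w w∈ → lift (on-line i x∈ (⟂-sym (lower (w∈ (i , i≢j ∘ ≡.sym)))))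
      -- If `x` were not orthogonal to `v i`, then `v i` would be a multiple of `x` and thus
      -- orthogonal to the diagonal, against `oblique`.
      ; meet₀      = λ i → (λ {x} (x∈₀ , x∈) → lift (vanishes i x∈ (decidable-stable em λ vᵢ⟂̸x →
                       let a , v⟂ = clear (v i) (v i) x vᵢ⟂̸x
                           D = diamond (suc i)
                       in oblique φ i (⟂-sym (⟂-cancelʳ (⟂-resp (≈ᴹ-sym
                            (vanishes i (+-closed D {v i} (axis∈ i) (*ₗ-closed D a {x} x∈)) v⟂)) ⟂-0)
                            (⟂-* a (lower (x∈₀ tt))))))))
                   , λ {x} (lift p) → resp (meet-space (diamond zero) (diamond (suc i))) (≈ᴹ-sym p)
                       (0-closed (meet-space (diamond zero) (diamond (suc i))))
      -- `v i` is not orthogonal to the diagonal, so a multiple of it moves any `x` into the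
      -- hyperplane.
      ; join₀      = λ i → _ , λ {x} _ →
          let a , s⟂ = clear (diagonal φ) x (v i) (oblique φ i ∘ ⟂-sym)
          in swap {diamond zero} {diamond (suc i)} {x} (join-difference (diamond (suc i)) (diamond zero)
               (*ₗ-closed (diamond (suc i)) a {v i} (axis∈ i)) λ _ → lift s⟂)
      }
      where
      swap : ∀ {U W} → sum-space W U ⊑ sum-space U W
      swap (w , u , w∈ , u∈ , x≈) = u , w , u∈ , w∈ , ≈ᴹ-trans x≈ (+ᴹ-comm w u)

      1⊑⨆ : Hₛ H ⊑ ⨆ (diamond ∘ suc)
      -- The join is its own double orthocomplement, and only 0 is orthogonal to all axes.
      1⊑⨆ {x} _ = proj₁ (ModularOrtholattice.∼-involutive subspaces (⨆ (diamond ∘ suc)))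
        λ w w∈ → lift (⟂-sym (⟂-resp (≈ᴹ-sym (complete λ i →
          lower (w∈ (v i) (⨆-upper (diamond ∘ suc) i {v i} (axis∈ i))))) ⟂-0))

-- Codes of terms

-- A left inverse of `encode`, for its injectivity. Producing a list of terms makes the recursion
-- structural: an operator takes its arguments from the front of the list decoded from the rest.
decode : List Bool → List (Term ℕ)
decodeIndex : List Bool → ℕᵇ × List (Term ℕ)

decode (false ∷ false ∷ false ∷ s) = 0ₜ ∷ decode s
decode (false ∷ false ∷ true ∷ s)  = 1ₜ ∷ decode s
decode (false ∷ true ∷ false ∷ s) with decode s
... | t ∷ ts = ¬ₜ t ∷ ts
... | _      = []
decode (false ∷ true ∷ true ∷ s) with decode s
... | t ∷ u ∷ ts = t ∧ₜ u ∷ ts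
... | _          = []
decode (true ∷ false ∷ false ∷ s) with decode s
... | t ∷ u ∷ ts = t ∨ₜ u ∷ ts
... | _          = []
decode (true ∷ false ∷ true ∷ s) = let n , ts = decodeIndex s in var (toℕ n) ∷ ts
decode _ = []

decodeIndex (true ∷ false ∷ s) = let n , ts = decodeIndex s in 2[1+ n ] , ts
decodeIndex (true ∷ true ∷ s)  = let n , ts = decodeIndex s in 1+[2 n ] , ts
decodeIndex (false ∷ s)        = zero , decode s
decodeIndex _                  = zero , []

decodeIndex-encodeIndex : ∀ n s → decodeIndex (encodeIndex n ++ s) ≡ (n , decode s)
decodeIndex-encodeIndex zero     s = refl
decodeIndex-encodeIndex 2[1+ n ] s rewrite decodeIndex-encodeIndex n s = refl
decodeIndex-encodeIndex 1+[2 n ] s rewrite decodeIndex-encodeIndex n s = refl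

decode-encode : ∀ t s → decode (encode t ++ s) ≡ t ∷ decode s
decode-encode (var n) s rewrite decodeIndex-encodeIndex (fromℕ n) s | ℕᵇ.toℕ-fromℕ n = refl
decode-encode (t ∧ₜ u) s rewrite List.++-assoc (encode t) (encode u) s
  | decode-encode t (encode u ++ s) | decode-encode u s = refl
decode-encode (t ∨ₜ u) s rewrite List.++-assoc (encode t) (encode u) s
  | decode-encode t (encode u ++ s) | decode-encode u s = refl
decode-encode (¬ₜ t) s rewrite decode-encode t s = refl
decode-encode 0ₜ s = refl
decode-encode 1ₜ s = refl

encode-injective : ∀ {t u} → encode t ≡ encode u → t ≡ u
encode-injective {t} {u} e = List.∷-injectiveˡ
  (≡.trans (≡.sym (decode-encode t [])) (≡.trans (≡.cong (λ s → decode (s ++ [])) e) (decode-encode u [])))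

encode-nonempty : ∀ t → ¬ encode t ≡ []
encode-nonempty (var _)  ()
encode-nonempty (_ ∧ₜ _) ()
encode-nonempty (_ ∨ₜ _) ()
encode-nonempty (¬ₜ _)   ()
encode-nonempty 0ₜ       ()
encode-nonempty 1ₜ       ()

-- In the code of a variable, passing from n to odd n inserts the two bits true, true before the index.
odd : ℕ → ℕ
odd n = toℕ 1+[2 fromℕ n ]

-- `one` and `two` hold the bits already read of a three-bit symbol; `index` awaits a continuation
-- bit, `digit` the binary digit after it.
data Scan : Set where
  start index digit : Scan
  one : Bool → Scan
  two : Bool → Bool → Scan

-- The move is that of the counter head: the end of a leaf closes a pending term, a negation
-- replaces one by one, a binary operator one by two.
data Outcome : Set where
  continue : Scan → Move → Outcome
  renumber : Outcome

-- The counter holds the number of terms that remain to be read.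
consume : Bool → Scan → Bool → Maybe Outcome
consume true  _                _     = nothing
consume false start            b     = just (continue (one b) stay)
consume false (one true)       true  = nothing
consume false (one b)          c     = just (continue (two b c) stay)
consume false (two false false) _    = just (continue start left)
consume false (two false true) false = just (continue start stay)
consume false (two false true) true  = just (continue start right)
consume false (two true _)     false = just (continue start right)
consume false (two true _)     true  = just renumber
consume false index            true  = just (continue digit stay)
consume false index            false = just (continue start left)
consume false digit            _     = just (continue index stay)

isZero : ℕ → Bool
isZero zero    = true
isZero (suc _) = false

shift : Move → ℕ → ℕ
shift left  = pred
shift stay  = id
shift right = suc

-- What one pass of the machine over its input writes, with `nothing` where the machine jams.
transduce : Scan → ℕ → List Bool → Maybe (List Bool)
resume    : Bool → Maybe Outcome → ℕ → List Bool → Maybe (List Bool)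

transduce q     k    (b ∷ s) = resume b (consume (isZero k) q b) k s
transduce start zero []      = just []
transduce _     _    []      = nothing

resume b nothing               k s = nothing
resume b (just (continue q m)) k s = Maybe.map (b ∷_) (transduce q (shift m k) s)
resume b (just renumber)      k s = Maybe.map (λ o → b ∷ true ∷ true ∷ o) (transduce index k s)

private
  map₂ : ∀ {A B C : Set} {g : B → C} {f : A → B} x → Maybe.map g (Maybe.map f x) ≡ Maybe.map (g ∘ f) x
  map₂ (just _) = refl
  map₂ nothing  = refl

  map₃ : ∀ {A B C D : Set} {h : C → D} {g : B → C} {f : A → B} x →
    Maybe.map h (Maybe.map g (Maybe.map f x)) ≡ Maybe.map (h ∘ g ∘ f) x
  map₃ (just _) = refl
  map₃ nothing  = refl

transduce-index : ∀ n k s →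
  transduce index (suc k) (encodeIndex n ++ s) ≡ Maybe.map (encodeIndex n ++_) (transduce start k s)
transduce-index zero     k s = refl
transduce-index 2[1+ n ] k s rewrite transduce-index n k s = map₃ (transduce start k s)
transduce-index 1+[2 n ] k s rewrite transduce-index n k s = map₃ (transduce start k s)

-- With an arbitrary remainder `s` and counter `k`, the two arguments of an operator are read in
-- turn: the first with the second as part of its remainder.
transduce-encode : ∀ t k s →
  transduce start (suc k) (encode t ++ s) ≡ Maybe.map (encode (rename odd t) ++_) (transduce start k s)
transduce-encode 0ₜ k s = map₃ (transduce start k s)
transduce-encode 1ₜ k s = map₃ (transduce start k s)
transduce-encode (¬ₜ t) k s rewrite transduce-encode t k s =
  ≡.trans (map₃ (Maybe.map (encode (rename odd t) ++_) (transduce start k s))) (map₂ (transduce start k s))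
transduce-encode (var n) k s
  rewrite transduce-index (fromℕ n) k s | ℕᵇ.fromℕ-toℕ 1+[2 fromℕ n ] =
  ≡.trans (map₃ (Maybe.map (encodeIndex (fromℕ n) ++_) (transduce start k s))) (map₂ (transduce start k s))
transduce-encode (t ∧ₜ u) k s
  rewrite List.++-assoc (encode t) (encode u) s
        | transduce-encode t (suc k) (encode u ++ s) | transduce-encode u k s
  with transduce start k s
... | nothing = refl
... | just o  = ≡.cong (λ z → just (false ∷ true ∷ true ∷ z))
                  (≡.sym (List.++-assoc (encode (rename odd t)) (encode (rename odd u)) o))
transduce-encode (t ∨ₜ u) k s
  rewrite List.++-assoc (encode t) (encode u) s
        | transduce-encode t (suc k) (encode u ++ s) | transduce-encode u k s
  with transduce start k s
... | nothing = refl
... | just o  = ≡.cong (λ z → just (true ∷ false ∷ false ∷ z))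
                  (≡.sym (List.++-assoc (encode (rename odd t)) (encode (rename odd u)) o))

encodes : ∀ {k} → Vec (Term ℕ) k → List Bool
encodes []       = []
encodes (t ∷ ts) = encode t ++ encodes ts

private
  premap : ∀ {A B : Set} {f : A → B} {x : Maybe A} → ¬ Maybe.map f x ≡ nothing → ¬ x ≡ nothing
  premap {f = f} h = h ∘ ≡.cong (Maybe.map f)

-- The counter is general because a binary symbol raises it; the first two of the terms then found
-- become the arguments of the operator.
transduce-sound : ∀ k s → ¬ transduce start k s ≡ nothing →
  ∃ λ (ts : Vec (Term ℕ) k) → s ≡ encodes ts
transduce-sound-index : ∀ k s → ¬ transduce index (suc k) s ≡ nothing →
  ∃[ n ] ∃ λ (ts : Vec (Term ℕ) k) → s ≡ encodeIndex n ++ encodes ts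

transduce-sound zero    []      _ = [] , refl
transduce-sound zero    (_ ∷ _) h = ⊥-elim (h refl)
transduce-sound (suc k) []      h = ⊥-elim (h refl)
transduce-sound (suc k) (_ ∷ []) h = ⊥-elim (h refl)
transduce-sound (suc k) (false ∷ _ ∷ []) h = ⊥-elim (h refl)
transduce-sound (suc k) (true ∷ false ∷ []) h = ⊥-elim (h refl)
transduce-sound (suc k) (true ∷ true ∷ _) h = ⊥-elim (h refl)
transduce-sound (suc k) (false ∷ false ∷ false ∷ s) h with transduce-sound k s (premap (premap (premap h)))
... | ts , refl = 0ₜ ∷ ts , refl
transduce-sound (suc k) (false ∷ false ∷ true ∷ s) h with transduce-sound k s (premap (premap (premap h)))
... | ts , refl = 1ₜ ∷ ts , refl
transduce-sound (suc k) (false ∷ true ∷ false ∷ s) h with transduce-sound (suc k) s (premap (premap (premap h)))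
... | t ∷ ts , refl = ¬ₜ t ∷ ts , refl
transduce-sound (suc k) (false ∷ true ∷ true ∷ s) h with transduce-sound (2 + k) s (premap (premap (premap h)))
... | t ∷ u ∷ ts , refl = t ∧ₜ u ∷ ts
  , ≡.cong (λ z → false ∷ true ∷ true ∷ z) (≡.sym (List.++-assoc (encode t) (encode u) (encodes ts)))
transduce-sound (suc k) (true ∷ false ∷ false ∷ s) h with transduce-sound (2 + k) s (premap (premap (premap h)))
... | t ∷ u ∷ ts , refl = t ∨ₜ u ∷ ts
  , ≡.cong (λ z → true ∷ false ∷ false ∷ z) (≡.sym (List.++-assoc (encode t) (encode u) (encodes ts)))
transduce-sound (suc k) (true ∷ false ∷ true ∷ s) h with transduce-sound-index k s (premap (premap (premap h)))
... | n , ts , refl = var (toℕ n) ∷ ts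
  , ≡.cong (λ m → true ∷ false ∷ true ∷ encodeIndex m ++ encodes ts) (≡.sym (ℕᵇ.fromℕ-toℕ n))

transduce-sound-index k [] h = ⊥-elim (h refl)
transduce-sound-index k (false ∷ s) h with transduce-sound k s (premap h)
... | ts , refl = zero , ts , refl
transduce-sound-index k (true ∷ []) h = ⊥-elim (h refl)
transduce-sound-index k (true ∷ false ∷ s) h with transduce-sound-index k s (premap (premap h))
... | n , ts , refl = 2[1+ n ] , ts , refl
transduce-sound-index k (true ∷ true ∷ s) h with transduce-sound-index k s (premap (premap h))
... | n , ts , refl = 1+[2 n ] , ts , refl

-- The factor 3 comes from `renumber`, which writes three bits for the one it reads.
transduce-length : ∀ q k s {o} → transduce q k s ≡ just o → length o ℕ.≤ 3 * length s
transduce-length start zero    [] refl = ℕ.z≤n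
transduce-length q k (b ∷ s) eq with consume (isZero k) q b
... | just (continue q′ m) with transduce q′ (shift m k) s in e
...   | just o with refl ← eq = ℕ.≤-trans (ℕ.s≤s (transduce-length q′ (shift m k) s e))
                          (ℕ.≤-trans (ℕ.m≤n+m _ 2) (ℕ.≤-reflexive (≡.sym (ℕ.*-suc 3 (length s)))))
transduce-length q k (b ∷ s) eq | just renumber with transduce index k s in e
...   | just o with refl ← eq = ℕ.≤-trans (ℕ.+-monoʳ-≤ 3 (transduce-length index k s e))
                          (ℕ.≤-reflexive (≡.sym (ℕ.*-suc 3 (length s))))

-- A linear-time machine

data Instruction : Set where
  emit : Bool → Instruction
  copy : Instruction

Program : Set
Program = List Instruction

execute : Program → List Bool → Maybe (List Bool)
execute []           s = just []
execute (emit b ∷ p) s = Maybe.map (b ∷_) (execute p s)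
execute (copy ∷ p)   s = transduce start 1 s Maybe.>>= λ o → Maybe.map (o ++_) (execute p s)

-- `boot` puts the marker on the counter tape, `mark₁` and `mark₂` write the two bits inserted by
-- `renumber`, `rewind` returns the input head after a copy, and `home` the output head at the end.
data Phase : Set where
  boot ready mark₁ mark₂ rewind home halt : Phase
  scan : Scan → Phase

private
  phases : Vec Phase 16
  phases = boot ∷ ready ∷ mark₁ ∷ mark₂ ∷ rewind ∷ home ∷ halt ∷ scan start ∷ scan index ∷ scan digit
    ∷ scan (one false) ∷ scan (one true) ∷ scan (two false false) ∷ scan (two false true)
    ∷ scan (two true false) ∷ scan (two true true) ∷ []

  phaseIndex : Phase → Fin 16
  phaseIndex boot                    = # 0
  phaseIndex ready                   = # 1
  phaseIndex mark₁                   = # 2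
  phaseIndex mark₂                   = # 3
  phaseIndex rewind                  = # 4
  phaseIndex home                    = # 5
  phaseIndex halt                    = # 6
  phaseIndex (scan start)            = # 7
  phaseIndex (scan index)            = # 8
  phaseIndex (scan digit)            = # 9
  phaseIndex (scan (one false))      = # 10
  phaseIndex (scan (one true))       = # 11
  phaseIndex (scan (two false false)) = # 12
  phaseIndex (scan (two false true)) = # 13
  phaseIndex (scan (two true false)) = # 14
  phaseIndex (scan (two true true))  = # 15

  phaseIndex-inverse : ∀ q → Vec.lookup phases (phaseIndex q) ≡ q
  phaseIndex-inverse boot                     = refl
  phaseIndex-inverse ready                    = refl
  phaseIndex-inverse mark₁                    = refl
  phaseIndex-inverse mark₂                    = refl
  phaseIndex-inverse rewind                   = refl
  phaseIndex-inverse home                     = refl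
  phaseIndex-inverse halt                     = refl
  phaseIndex-inverse (scan start)             = refl
  phaseIndex-inverse (scan index)             = refl
  phaseIndex-inverse (scan digit)             = refl
  phaseIndex-inverse (scan (one false))       = refl
  phaseIndex-inverse (scan (one true))        = refl
  phaseIndex-inverse (scan (two false false)) = refl
  phaseIndex-inverse (scan (two false true))  = refl
  phaseIndex-inverse (scan (two true false))  = refl
  phaseIndex-inverse (scan (two true true))   = refl

phase↔Fin : Phase ↔ Fin 16
phase↔Fin = mk↔ₛ′ phaseIndex (Vec.lookup phases)
  (from-yes (Fin.all? λ i → phaseIndex (Vec.lookup phases i) Fin.≟ i)) phaseIndex-inverse

Position : Program → Set
Position p = Fin (suc (length p))

remaining : ∀ p → Position p → Program
remaining p       zero    = p
remaining (_ ∷ p) (suc i) = remaining p i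

next : ∀ p → Position p → Position p
next []      zero    = zero
next (_ ∷ _) zero    = suc zero
next (_ ∷ p) (suc i) = suc (next p i)

remaining-next : ∀ p i {x r} → remaining p i ≡ x ∷ r → remaining p (next p i) ≡ r
remaining-next (_ ∷ p) zero    refl = refl
remaining-next (_ ∷ p) (suc i) eq   = remaining-next p i eq

-- The counter tape is blank but for a marker on cell 0; the counter is the head position.
pattern marker = aux zero

isMarker : Symbol 1 → Bool
isMarker (aux _) = true
isMarker _       = false

private
  Action : Set
  Action = Symbol 1 × Move

  Transition : Program → Set
  Transition p = Maybe ((Position p × Phase) × Vec Action 3)

module _ (p : Program) where

  consumed : Position p → Bool → Symbol 1 → Maybe Outcome → Transition p
  consumed i b c nothing               = nothing
  consumed i b c (just (continue q m)) =
    just ((i , scan q) , (bit b , right) ∷ (bit b , right) ∷ (c , m) ∷ [])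
  consumed i b c (just renumber)       =
    just ((i , mark₁) , (bit b , right) ∷ (bit b , right) ∷ (c , stay) ∷ [])

  dispatch : Program → Position p → Symbol 1 → Symbol 1 → Symbol 1 → Transition p
  dispatch []           i x o c = just ((i , home) , (x , stay) ∷ (o , left) ∷ (c , stay) ∷ [])
  dispatch (emit b ∷ _) i x o c = just ((next p i , ready) , (x , stay) ∷ (bit b , right) ∷ (c , stay) ∷ [])
  dispatch (copy ∷ _)   i x o c = just ((i , scan start) , (x , stay) ∷ (o , stay) ∷ (c , right) ∷ [])

  transition : Position p → Phase → Symbol 1 → Symbol 1 → Symbol 1 → Transition p
  transition i boot         x o c = just ((i , ready) , (x , stay) ∷ (o , stay) ∷ (marker , stay) ∷ [])
  transition i ready        x o c = dispatch (remaining p i) i x o c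
  transition i (scan q) (bit b) o c = consumed i b c (consume (isMarker c) q b)
  transition i (scan start) blank o marker =
    just ((i , rewind) , (blank , left) ∷ (o , stay) ∷ (marker , stay) ∷ [])
  transition i (scan _)     _ _ _ = nothing
  transition i mark₁        x o c = just ((i , mark₂) , (x , stay) ∷ (bit true , right) ∷ (c , stay) ∷ [])
  transition i mark₂        x o c = just ((i , scan index) , (x , stay) ∷ (bit true , right) ∷ (c , stay) ∷ [])
  transition i rewind (bit b) o c = just ((i , rewind) , (bit b , left) ∷ (o , stay) ∷ (c , stay) ∷ [])
  transition i rewind       x o c = just ((next p i , ready) , (x , right) ∷ (o , stay) ∷ (c , stay) ∷ [])
  transition i home   x (bit b) c = just ((i , home) , (x , stay) ∷ (bit b , left) ∷ (c , stay) ∷ [])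
  transition i home         x o c = just ((i , halt) , (x , stay) ∷ (o , right) ∷ (c , stay) ∷ [])
  transition i halt         x o c = nothing

  machine : TuringMachine
  machine = record
    { tapeCount = 3
    ; auxCount = 1
    ; State = Position p × Phase
    ; finite = ↔-sym Fin.*↔× ↔-∘ (↔-id (Position p) ×-↔ phase↔Fin)
    ; start = zero , boot
    ; input = zero
    ; output = suc zero
    ; δ = λ { (i , q) (x ∷ o ∷ c ∷ []) → transition i q x o c }
    }

-- The head stands on the first cell of the second list, or on a blank if that list is empty;
-- `leftOf` is the tape just after a move to the left.
cells : List (Symbol 1) → List (Symbol 1) → Tape 1
cells B []       = tape B blank []
cells B (x ∷ xs) = tape B x xs

leftOf : List (Symbol 1) → List (Symbol 1) → Tape 1
leftOf []      X = tape [] blank X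
leftOf (b ∷ B) X = tape B b X

blanks : ℕ → List (Symbol 1)
blanks n = replicate n blank

-- `j` counts the blank cells already visited to the right of the head; they carry no information
-- but are part of the representation.
counter : ℕ → ℕ → Tape 1
counter zero    j = tape [] marker (blanks j)
counter (suc k) j = tape (blanks k ++ marker ∷ []) blank (blanks j)

move-right : ∀ x y B X → writeAndMove (x , right) (tape B y X) ≡ cells (x ∷ B) X
move-right x y B []      = refl
move-right x y B (_ ∷ _) = refl

move-left : ∀ x y B X → writeAndMove (x , left) (tape B y X) ≡ leftOf B (x ∷ X)
move-left x y []      X = refl
move-left x y (_ ∷ _) X = refl

counter-move : ∀ m k j → ∃[ j′ ]
  writeAndMove (blank , m) (counter (suc k) j) ≡ counter (shift m (suc k)) j′
counter-move left  zero    j = suc j , refl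
counter-move left  (suc k) j = suc j , refl
counter-move stay  k       j = j , refl
counter-move right k zero    = 0 , refl
counter-move right k (suc j) = j , refl

private
  bits : List Bool → List (Symbol 1)
  bits = map bit

bits-ʳ++ : ∀ s C X → bits (s ʳ++ C) ʳ++ X ≡ bits C ʳ++ (bits s ++ X)
bits-ʳ++ []      C X = refl
bits-ʳ++ (b ∷ s) C X = bits-ʳ++ s (b ∷ C) X

bits-reverse : ∀ s X → bits s ʳ++ X ≡ bits (reverse s) ++ X
bits-reverse s X = ≡.trans (≡.cong (λ z → bits z ʳ++ X) (≡.sym (List.reverse-involutive s)))
  (bits-ʳ++ (reverse s) [] X)

-- The metavariable in the type of readTape-block stands for the function local to readTape,
-- which cannot be named here.
readTape-block : ∀ (B : List (Symbol 1)) s as w out → w ≡ bits out ++ blank ∷ [] → _ ≡ out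

readTape-cells : ∀ B s as out → s ∷ as ≡ bits out ++ blank ∷ [] → readTape (tape B s as) ≡ out
readTape-cells B s as out eq with s ∷ as
... | w = readTape-block B s as w out eq

readTape-block B s as _ []        refl = refl
readTape-block B s as _ (b ∷ out) refl = ≡.cong (b ∷_) (readTape-block B s as _ out refl)

readTape-block-cells : ∀ B X out → X ≡ bits out ++ blank ∷ [] → readTape (cells B X) ≡ out
readTape-block-cells B []      []      ()
readTape-block-cells B []      (_ ∷ _) ()
readTape-block-cells B (x ∷ X) out eq = readTape-cells B x X out eq

-- Each instruction also pays for the final walk back over what it writes. A copy takes 1 step to
-- enter, at most `3 * n` to scan, 1 to leave the end, `n + 1` to rewind, and at most `3 * n` on the
-- way home. An emit is one step out and one back; the 2 at the end turn the head around and place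
-- it on the first bit.
cost : Program → ℕ → ℕ
cost []           n = 2
cost (emit _ ∷ p) n = 2 + cost p n
cost (copy ∷ p)   n = 3 + 7 * n + cost p n

private
  sum-of-costs : ∀ n c r → suc (3 * n + (2 + n + (c + (3 * n + r)))) ≡ 3 + 7 * n + c + r
  sum-of-costs = solve 3 (λ n c r →
    con 1 :+ (con 3 :* n :+ (con 2 :+ n :+ (c :+ (con 3 :* n :+ r)))) := con 3 :+ con 7 :* n :+ c :+ r) refl

cost≤ : ∀ p n → cost p n ℕ.≤ (2 + 7 * length p) * n + (2 + 7 * length p)
cost≤ []           n = ℕ.m≤n+m 2 (2 * n)
cost≤ (emit _ ∷ p) n = ℕ.≤-trans (ℕ.+-monoʳ-≤ 2 (cost≤ p n)) (ℕ.≤-trans (ℕ.m≤m+n _ (5 + 7 * n)) (ℕ.≤-reflexive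
  (solve 2 (λ l n → con 2 :+ ((con 2 :+ con 7 :* l) :* n :+ (con 2 :+ con 7 :* l)) :+ (con 5 :+ con 7 :* n)
    := (con 2 :+ con 7 :* (con 1 :+ l)) :* n :+ (con 2 :+ con 7 :* (con 1 :+ l))) refl (length p) n)))
cost≤ (copy ∷ p)   n = ℕ.≤-trans (ℕ.+-monoʳ-≤ (3 + 7 * n) (cost≤ p n)) (ℕ.≤-trans (ℕ.m≤m+n _ 4) (ℕ.≤-reflexive
  (solve 2 (λ l n → con 3 :+ con 7 :* n :+ ((con 2 :+ con 7 :* l) :* n :+ (con 2 :+ con 7 :* l)) :+ con 4
    := (con 2 :+ con 7 :* (con 1 :+ l)) :* n :+ (con 2 :+ con 7 :* (con 1 :+ l))) refl (length p) n)))

-- Runs of the machine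

module Execution (p : Program) where
  open TuringMachine (machine p) using (Config; step; run; initial; result)

  configuration : Position p → Phase → (x o c : Tape 1) → Config
  configuration i q x o c = (i , q) , x ∷ o ∷ c ∷ []

  Halts : Config → ℕ → List Bool → Set
  Halts c b out = ∃[ n ] n ℕ.≤ b × step (run n c) ≡ nothing × result (run n c) ≡ out

  halts-step : ∀ {c c′ b out} → step c ≡ just c′ → Halts c′ b out → Halts c (suc b) out
  halts-step {c} {c′} e (n , n≤b , stop , res) = suc n , ℕ.s≤s n≤b
    , ≡.trans (≡.cong step unfold) stop , ≡.trans (≡.cong result unfold) res
    where
    unfold : run (suc n) c ≡ run n c′
    unfold = ≡.cong (maybe′ (run n) c) e

  halts-weaken : ∀ {c b b′ out} → b ℕ.≤ b′ → Halts c b out → Halts c b′ out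
  halts-weaken b≤b′ (n , n≤b , h) = n , ℕ.≤-trans n≤b b≤b′ , h

  step-just : ∀ i q x o c {i′ q′ x′ o′ c′ mx mo mc} →
    transition p i q (scanned x) (scanned o) (scanned c) ≡ just ((i′ , q′) , mx ∷ mo ∷ mc ∷ []) →
    writeAndMove mx x ≡ x′ → writeAndMove mo o ≡ o′ → writeAndMove mc c ≡ c′ →
    step (configuration i q x o c) ≡ just (configuration i′ q′ x′ o′ c′)
  step-just i q x o c e refl refl refl =
    ≡.cong (Maybe.map λ (q′ , actions) → q′ , Vec.zipWith writeAndMove actions (x ∷ o ∷ c ∷ [])) e

  step-nothing : ∀ i q x o c → transition p i q (scanned x) (scanned o) (scanned c) ≡ nothing →
    step (configuration i q x o c) ≡ nothing
  step-nothing i q x o c e =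
    ≡.cong (Maybe.map λ (q′ , actions) → q′ , Vec.zipWith writeAndMove actions (x ∷ o ∷ c ∷ [])) e

  written : List Bool → Tape 1
  written R = tape (bits R) blank []

  -- While it writes, the output head stands on a blank: a machine that jams outputs [], which codes no term.
  stuck : ∀ {i q x R c b out} → step (configuration i q x (written R) c) ≡ nothing → out ≡ [] →
    Halts (configuration i q x (written R) c) b out
  stuck e refl = 0 , ℕ.z≤n , e , refl

  scanned-blanks : ∀ B e → scanned (cells B (blanks e)) ≡ blank
  scanned-blanks B zero    = refl
  scanned-blanks B (suc e) = refl

  module _ (Z : List (Symbol 1)) (e : ℕ) {b : ℕ} {out : List Bool} where

    source : List Bool → List Bool → Tape 1
    source C s = cells (bits C ++ Z) (bits s ++ blanks e)

    -- What is to be known about the rest of the run: how it goes on once the input is read with no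
    -- term pending, and that after a jam the expected output is empty. It passes through the
    -- recursion without a case split on the result of `transduce`.
    Continue : Position p → List Bool → List Bool → Maybe (List Bool) → Set
    Continue i D R t = (∀ o j → t ≡ just o →
        Halts (configuration i (scan start) (source D []) (written (o ʳ++ R)) (counter 0 j)) b out)
      × (t ≡ nothing → out ≡ [])

    -- `C` and `R` list the bits read and written, nearest to the head first. A bit takes one step,
    -- or three if it triggers `renumber`.
    scan-halts : ∀ s i q k C R j → Continue i (s ʳ++ C) R (transduce q k s) →
      Halts (configuration i (scan q) (source C s) (written R) (counter k j)) (3 * length s + b) out
    resume-halts : ∀ x s i q k C R j outcome → consume false q x ≡ outcome →
      Continue i (s ʳ++ (x ∷ C)) R (resume x outcome (suc k) s) →
      Halts (configuration i (scan q) (source C (x ∷ s)) (written R) (counter (suc k) j))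
            (3 * length (x ∷ s) + b) out

    scan-halts []      i q k C R j (K , F) = at-end q k refl K F
      where
      jam : ∀ q k → transition p i (scan q) blank blank (scanned (counter k j)) ≡ nothing →
        step (configuration i (scan q) (source C []) (written R) (counter k j)) ≡ nothing
      jam q k eq = step-nothing i (scan q) (source C []) (written R) (counter k j)
        (≡.trans (≡.cong (λ x → transition p i (scan q) x blank (scanned (counter k j)))
          (scanned-blanks (bits C ++ Z) e)) eq)

      at-end : ∀ q k {t} → transduce q k [] ≡ t →
        (∀ o j → t ≡ just o →
          Halts (configuration i (scan start) (source C []) (written (o ʳ++ R)) (counter 0 j)) b out) →
        (t ≡ nothing → out ≡ []) →
        Halts (configuration i (scan q) (source C []) (written R) (counter k j)) b out
      at-end start     zero    refl K F = K [] j refl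
      at-end start     (suc k) refl K F = stuck (jam start (suc k) refl) (F refl)
      at-end index     k       refl K F = stuck (jam index k refl) (F refl)
      at-end digit     k       refl K F = stuck (jam digit k refl) (F refl)
      at-end (one x)   k       refl K F = stuck (jam (one x) k refl) (F refl)
      at-end (two x y) k       refl K F = stuck (jam (two x y) k refl) (F refl)
    scan-halts (x ∷ s) i q zero    C R j (K , F) =
      stuck (step-nothing i (scan q) (source C (x ∷ s)) (written R) (counter 0 j) refl) (F refl)
    scan-halts (x ∷ s) i q (suc k) C R j KF =
      resume-halts x s i q k C R j (consume false q x) refl KF

    resume-halts x s i q k C R j nothing eq (K , F) = stuck
      (step-nothing i (scan q) (source C (x ∷ s)) (written R) (counter (suc k) j)
        (≡.cong (consumed p i x blank) eq)) (F refl)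
    resume-halts x s i q k C R j (just (continue q′ m)) eq (K , F) with counter-move m k j
    ... | j′ , moved = halts-weaken
      (ℕ.+-monoˡ-≤ b (ℕ.≤-trans (ℕ.m≤n+m (suc (3 * length s)) 2)
        (ℕ.≤-reflexive (≡.sym (ℕ.*-suc 3 (length s))))))
      (halts-step (step-just i (scan q) (source C (x ∷ s)) (written R) (counter (suc k) j)
          (≡.cong (consumed p i x blank) eq) (move-right (bit x) (bit x) (bits C ++ Z) (bits s ++ blanks e)) refl moved)
        (scan-halts s i q′ (shift m (suc k)) (x ∷ C) (x ∷ R) j′
          ((λ o j″ t≡ → K (x ∷ o) j″ (≡.cong (Maybe.map (x ∷_)) t≡)) , λ t≡ → F (≡.cong (Maybe.map (x ∷_)) t≡))))
    resume-halts x s i q k C R j (just renumber) eq (K , F) = halts-weaken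
      (ℕ.+-monoˡ-≤ b (ℕ.≤-reflexive (≡.sym (ℕ.*-suc 3 (length s)))))
      (halts-step (step-just i (scan q) (source C (x ∷ s)) (written R) (counter (suc k) j)
          (≡.cong (consumed p i x blank) eq) (move-right (bit x) (bit x) (bits C ++ Z) (bits s ++ blanks e)) refl refl)
        (halts-step (step-just i mark₁ (source (x ∷ C) s) (written (x ∷ R)) (counter (suc k) j) refl refl refl refl)
          (halts-step (step-just i mark₂ (source (x ∷ C) s) (written (true ∷ x ∷ R)) (counter (suc k) j) refl refl refl refl)
            (scan-halts s i index (suc k) (x ∷ C) (true ∷ true ∷ x ∷ R) j
              ((λ o j″ t≡ → K (x ∷ true ∷ true ∷ o) j″ (≡.cong (Maybe.map λ o → x ∷ true ∷ true ∷ o) t≡))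
              , λ t≡ → F (≡.cong (Maybe.map λ o → x ∷ true ∷ true ∷ o) t≡))))))

  -- A head that runs past an end of the input adds a blank there, whence the varying margins z and e.
  rewind-halts : ∀ D i z X R j {b out} →
    (∀ z′ → Halts (configuration (next p i) ready (cells (blanks z′) (bits D ʳ++ X)) (written R) (counter 0 j)) b out) →
    Halts (configuration i rewind (leftOf (bits D ++ blanks z) X) (written R) (counter 0 j)) (suc (length D) + b) out
  rewind-halts []      i zero    X R j K = halts-step
    (step-just i rewind (tape [] blank X) (written R) (counter 0 j) refl (move-right blank blank [] X) refl refl) (K 1)
  rewind-halts []      i (suc z) X R j K = halts-step
    (step-just i rewind (tape (blanks z) blank X) (written R) (counter 0 j) refl
      (move-right blank blank (blanks z) X) refl refl) (K (suc z))
  rewind-halts (x ∷ D) i z X R j K = halts-step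
    (step-just i rewind (tape (bits D ++ blanks z) (bit x) X) (written R) (counter 0 j) refl
      (move-left (bit x) (bit x) (bits D ++ blanks z) X) refl refl)
    (rewind-halts D i z (bit x ∷ X) R j K)

  home-halts : ∀ R i x X c {out} → readTape (cells (blank ∷ []) (bits R ʳ++ X)) ≡ out →
    Halts (configuration i home x (leftOf (bits R) X) c) (suc (length R)) out
  home-halts []      i x X c eq = halts-step
    (step-just i home x (tape [] blank X) c refl refl (move-right blank blank [] X) refl)
    (0 , ℕ.z≤n , refl , eq)
  home-halts (r ∷ R) i x X c eq = halts-step
    (step-just i home x (tape (bits R) (bit r) X) c refl refl (move-left (bit r) (bit r) (bits R) X) refl)
    (home-halts R i x (bit r ∷ X) c eq)

  outputFrom : List Bool → Maybe (List Bool) → List Bool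
  outputFrom R = maybe′ (λ o → reverse (o ʳ++ R)) []

  outputFrom-++ : ∀ R o t → outputFrom (o ʳ++ R) t ≡ outputFrom R (Maybe.map (o ++_) t)
  outputFrom-++ R o nothing   = refl
  outputFrom-++ R o (just o′) = ≡.cong reverse (≡.sym (List.++-ʳ++ o))

  leave-end : ∀ B e → writeAndMove (blank , left) (cells B (blanks e)) ≡ leftOf B (blanks (suc (pred e)))
  leave-end B zero    = move-left blank blank B []
  leave-end B (suc e) = move-left blank blank B (blanks e)

  -- The summand `length R` pays for the way home over the output present so far; a copy lengthens
  -- it by at most `3 * length s`.
  ready-halts : ∀ r i → remaining p i ≡ r → ∀ s z e R j →
    Halts (configuration i ready (cells (blanks z) (bits s ++ blanks e)) (written R) (counter 0 j))
          (cost r (length s) + length R) (outputFrom R (execute r s))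
  ready-halts [] i eq s z e R j = halts-step
    (step-just i ready (source′) (written R) (counter 0 j)
      (≡.cong (λ r → dispatch p r i (scanned source′) blank marker) eq) refl (move-left blank blank (bits R) []) refl)
    (home-halts R i source′ (blank ∷ []) (counter 0 j)
      (readTape-block-cells (blank ∷ []) _ (reverse R) (bits-reverse R (blank ∷ []))))
    where source′ = cells (blanks z) (bits s ++ blanks e)
  ready-halts (emit x ∷ r) i eq s z e R j = ≡.subst (Halts _ _) (outputFrom-++ R (x ∷ []) (execute r s))
    (halts-weaken (ℕ.≤-reflexive (≡.cong suc (ℕ.+-suc (cost r (length s)) (length R))))
      (halts-step (step-just i ready source′ (written R) (counter 0 j)
          (≡.cong (λ r → dispatch p r i (scanned source′) blank marker) eq) refl refl refl)
        (ready-halts r (next p i) (remaining-next p i eq) s z e (x ∷ R) j)))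
    where source′ = cells (blanks z) (bits s ++ blanks e)
  ready-halts (copy ∷ r) i eq s z e R j = halts-weaken (ℕ.≤-reflexive (sum-of-costs N (cost r N) (length R)))
    (halts-step (step-just i ready source′ (written R) (counter 0 j)
        (≡.cong (λ r → dispatch p r i (scanned source′) blank marker) eq) refl refl (proj₂ (enter j)))
      (scan-halts (blanks z) e {b = 2 + length s + (cost r N + (3 * N + length R))} s i start 1 [] R (proj₁ (enter j))
        ( (λ o j′ t≡ → halts-step
            (step-just i (scan start) (cells (bits (s ʳ++ []) ++ blanks z) (blanks e)) (written (o ʳ++ R)) (counter 0 j′)
              (≡.cong (λ x → transition p i (scan start) x blank marker) (scanned-blanks _ e))
              (leave-end _ e) refl refl)
            (halts-weaken (ℕ.≤-reflexive (≡.cong (λ l → suc (l + (cost r N + (3 * N + length R)))) (List.length-reverse s)))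
              (rewind-halts (s ʳ++ []) i z (blanks (suc (pred e))) (o ʳ++ R) j′ λ z′ →
                again o j′ t≡ z′)))
        , λ t≡ → ≡.cong (λ t → outputFrom R (t Maybe.>>= λ o → Maybe.map (o ++_) (execute r s))) t≡)))
    where
    N = length s
    source′ = cells (blanks z) (bits s ++ blanks e)

    enter : ∀ j → ∃[ j′ ] writeAndMove (marker , right) (counter 0 j) ≡ counter 1 j′
    enter zero    = 0 , refl
    enter (suc j) = j , refl

    again : ∀ o j′ → transduce start 1 s ≡ just o → ∀ z′ →
      Halts (configuration (next p i) ready (cells (blanks z′) (bits (s ʳ++ []) ʳ++ blanks (suc (pred e))))
              (written (o ʳ++ R)) (counter 0 j′))
        (cost r N + (3 * N + length R)) (outputFrom R (execute (copy ∷ r) s))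
    again o j′ t≡ z′ = ≡.subst₂ (λ X → Halts (configuration (next p i) ready (cells (blanks z′) X)
        (written (o ʳ++ R)) (counter 0 j′)) _)
      (≡.sym (bits-ʳ++ s [] (blanks (suc (pred e)))))
      (≡.trans (outputFrom-++ R o (execute r s))
        (≡.cong (λ t → outputFrom R (t Maybe.>>= λ o → Maybe.map (o ++_) (execute r s))) (≡.sym t≡)))
      (halts-weaken (ℕ.+-monoʳ-≤ (cost r N) (ℕ.≤-trans (ℕ.≤-reflexive (List.length-ʳ++ o))
          (ℕ.+-monoˡ-≤ (length R) (transduce-length start 1 s t≡))))
        (ready-halts r (next p i) (remaining-next p i eq) s z′ (suc (pred e)) (o ʳ++ R) j′))

  loadTape-cells : ∀ s → loadTape {1} s ≡ cells (blanks 0) (bits s ++ blanks 0)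
  loadTape-cells []      = refl
  loadTape-cells (b ∷ s) = ≡.cong (tape [] (bit b)) (≡.sym (List.++-identityʳ (bits s)))

  machine-halts : ∀ s → Halts (initial s) (suc (cost p (length s) + 0)) (maybe′ id [] (execute p s))
  machine-halts s = halts-step
    (step-just zero boot (loadTape s) (written []) (written []) refl (loadTape-cells s) refl refl)
    (≡.subst (Halts _ _) (involutive (execute p s)) (ready-halts p zero refl s 0 0 [] 0))
    where
    involutive : ∀ t → outputFrom [] t ≡ maybe′ id [] t
    involutive nothing  = refl
    involutive (just o) = List.reverse-involutive o

-- One more than the constant in `cost≤`, for the boot step.
slope : Program → ℕ
slope p = 3 + 7 * length p

cost-bound : ∀ p n → suc (cost p n + 0) ℕ.≤ slope p * n ^ 1 + slope p
cost-bound p n = ℕ.≤-trans (ℕ.s≤s (ℕ.+-monoˡ-≤ 0 (cost≤ p n))) (ℕ.≤-trans (ℕ.m≤m+n _ n) (ℕ.≤-reflexive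
  (solve 2 (λ l n → con 1 :+ ((con 2 :+ con 7 :* l) :* n :+ (con 2 :+ con 7 :* l) :+ con 0) :+ n
    := (con 3 :+ con 7 :* l) :* (n :* con 1) :+ (con 3 :+ con 7 :* l)) refl (length p) n)))

program-polynomialTime : ∀ p → PolynomialTime (maybe′ id [] ∘ execute p)
program-polynomialTime p = machine p , slope p , 1 , λ s → 
  let n , n≤ , halts = Execution.machine-halts p s in n , ℕ.≤-trans n≤ (cost-bound p (length s)) , halts

-- Reductions

substitute : ∀ {v w} {V : Set v} {W : Set w} → (V → Term W) → Term V → Term W
substitute σ (var x)  = σ x
substitute σ (s ∧ₜ t) = substitute σ s ∧ₜ substitute σ t
substitute σ (s ∨ₜ t) = substitute σ s ∨ₜ substitute σ t
substitute σ (¬ₜ t)   = ¬ₜ substitute σ t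
substitute σ 0ₜ       = 0ₜ
substitute σ 1ₜ       = 1ₜ

module _ {c ℓ} (R : RawOrtholattice c ℓ) where
  open RawOrtholattice R

  eval-cong : ∀ {v} {V : Set v} {ρ ρ′ : V → Carrier} → (∀ x → ρ x ≡ ρ′ x) → ∀ t → eval R ρ t ≡ eval R ρ′ t
  eval-cong e (var x)  = e x
  eval-cong e (s ∧ₜ t) = ≡.cong₂ _∧_ (eval-cong e s) (eval-cong e t)
  eval-cong e (s ∨ₜ t) = ≡.cong₂ _∨_ (eval-cong e s) (eval-cong e t)
  eval-cong e (¬ₜ t)   = ≡.cong ∼_ (eval-cong e t)
  eval-cong e 0ₜ       = refl
  eval-cong e 1ₜ       = refl

  eval-rename : ∀ {v w} {V : Set v} {W : Set w} (ρ : W → Carrier) (f : V → W) t →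
    eval R ρ (rename f t) ≡ eval R (ρ ∘ f) t
  eval-rename ρ f (var x)  = refl
  eval-rename ρ f (s ∧ₜ t) = ≡.cong₂ _∧_ (eval-rename ρ f s) (eval-rename ρ f t)
  eval-rename ρ f (s ∨ₜ t) = ≡.cong₂ _∨_ (eval-rename ρ f s) (eval-rename ρ f t)
  eval-rename ρ f (¬ₜ t)   = ≡.cong ∼_ (eval-rename ρ f t)
  eval-rename ρ f 0ₜ       = refl
  eval-rename ρ f 1ₜ       = refl

  eval-substitute : ∀ {v w} {V : Set v} {W : Set w} (ρ : W → Carrier) (σ : V → Term W) t →
    eval R ρ (substitute σ t) ≡ eval R (eval R ρ ∘ σ) t
  eval-substitute ρ σ (var x)  = refl
  eval-substitute ρ σ (s ∧ₜ t) = ≡.cong₂ _∧_ (eval-substitute ρ σ s) (eval-substitute ρ σ t)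
  eval-substitute ρ σ (s ∨ₜ t) = ≡.cong₂ _∨_ (eval-substitute ρ σ s) (eval-substitute ρ σ t)
  eval-substitute ρ σ (¬ₜ t)   = ≡.cong ∼_ (eval-substitute ρ σ t)
  eval-substitute ρ σ 0ₜ       = refl
  eval-substitute ρ σ 1ₜ       = refl

-- The left summand is the hole for t, the right one holds the variables ȳ; h̃ and g̃ are
-- polymorphic in the variables and so can be instantiated here.
Context : ℕ → Set
Context n = Term (⊤ ⊎ Fin n)

even : ∀ {n} → Fin n → ℕ
even i = toℕ 2[1+ fromℕ (Fin.toℕ i) ]

fill : ∀ {n} → Term ℕ → Context n → Term ℕ
fill t = substitute [ const (rename odd t) , var ∘ even ]′

private
  clamp : ∀ {n} → ℕ → Fin (suc n)
  clamp {zero}  _       = zero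
  clamp {suc n} zero    = zero
  clamp {suc n} (suc k) = suc (clamp k)

  clamp-toℕ : ∀ {n} (i : Fin (suc n)) → clamp (Fin.toℕ i) ≡ i
  clamp-toℕ {zero}  zero    = refl
  clamp-toℕ {suc n} zero    = refl
  clamp-toℕ {suc n} (suc i) = ≡.cong suc (clamp-toℕ i)

  slotᵇ : ∀ {n} → ℕᵇ → ℕ ⊎ Fin (suc n)
  slotᵇ zero     = inj₁ 0
  slotᵇ 1+[2 m ] = inj₁ (toℕ m)
  slotᵇ 2[1+ m ] = inj₂ (clamp (toℕ m))

-- A common left inverse of `odd` and `even`, which merges an assignment of t and a diamond into one
-- assignment on ℕ. Its values at 0 and at larger even numbers are arbitrary defaults.
slot : ∀ {n} → ℕ → ℕ ⊎ Fin (suc n)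
slot = slotᵇ ∘ fromℕ

slot-odd : ∀ {n} k → slot {n} (odd k) ≡ inj₁ k
slot-odd k = ≡.trans (≡.cong slotᵇ (ℕᵇ.fromℕ-toℕ 1+[2 fromℕ k ])) (≡.cong inj₁ (ℕᵇ.toℕ-fromℕ k))

slot-even : ∀ {n} (i : Fin (suc n)) → slot (even i) ≡ inj₂ i
slot-even i = ≡.trans (≡.cong slotᵇ (ℕᵇ.fromℕ-toℕ 2[1+ fromℕ (Fin.toℕ i) ]))
  (≡.cong inj₂ (≡.trans (≡.cong clamp (ℕᵇ.toℕ-fromℕ (Fin.toℕ i))) (clamp-toℕ i)))

emits : List Bool → Program
emits = map emit

compile : ∀ {n} → Context n → Program
compile (var (inj₁ _)) = copy ∷ []
compile (var (inj₂ i)) = emits (encode (var (even i)))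
compile (s ∧ₜ t)       = emits (false ∷ true ∷ true ∷ []) ++ compile s ++ compile t
compile (s ∨ₜ t)       = emits (true ∷ false ∷ false ∷ []) ++ compile s ++ compile t
compile (¬ₜ t)         = emits (false ∷ true ∷ false ∷ []) ++ compile t
compile 0ₜ             = emits (encode 0ₜ)
compile 1ₜ             = emits (encode 1ₜ)

transduce-term : ∀ t → transduce start 1 (encode t) ≡ just (encode (rename odd t))
transduce-term t = ≡.trans (≡.cong (transduce start 1) (≡.sym (List.++-identityʳ (encode t))))
  (≡.trans (transduce-encode t 0 []) (≡.cong just (List.++-identityʳ _)))

private
  append : List Bool → Maybe (List Bool) → Maybe (List Bool)
  append o = Maybe.map (o ++_)

  append-++ : ∀ o o′ m → append o (append o′ m) ≡ append (o ++ o′) m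
  append-++ o o′ nothing  = refl
  append-++ o o′ (just z) = ≡.cong just (≡.sym (List.++-assoc o o′ z))

  append-[] : ∀ m → append [] m ≡ m
  append-[] nothing  = refl
  append-[] (just _) = refl

execute-emits : ∀ bs p s → execute (emits bs ++ p) s ≡ append bs (execute p s)
execute-emits []       p s = ≡.sym (append-[] (execute p s))
execute-emits (b ∷ bs) p s = ≡.trans (≡.cong (Maybe.map (b ∷_)) (execute-emits bs p s))
  (append-++ (b ∷ []) bs (execute p s))

execute-prefix : ∀ bs o p s m → execute p s ≡ append o m → execute (emits bs ++ p) s ≡ append (bs ++ o) m
execute-prefix bs o p s m e = ≡.trans (execute-emits bs p s)
  (≡.trans (≡.cong (append bs) e) (append-++ bs o m))

execute-compile : ∀ {n} t (C : Context n) p →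
  execute (compile C ++ p) (encode t) ≡ append (encode (fill t C)) (execute p (encode t))
execute-pair : ∀ {n} t (C D : Context n) p → execute ((compile C ++ compile D) ++ p) (encode t) ≡
  append (encode (fill t C) ++ encode (fill t D)) (execute p (encode t))

execute-compile t (var (inj₁ _)) p rewrite transduce-term t = refl
execute-compile t (var (inj₂ i)) p = execute-emits (encode (var (even i))) p (encode t)
execute-compile t (C ∧ₜ D) p = execute-prefix (false ∷ true ∷ true ∷ [])
  (encode (fill t C) ++ encode (fill t D)) ((compile C ++ compile D) ++ p) (encode t)
  (execute p (encode t)) (execute-pair t C D p)
execute-compile t (C ∨ₜ D) p = execute-prefix (true ∷ false ∷ false ∷ [])
  (encode (fill t C) ++ encode (fill t D)) ((compile C ++ compile D) ++ p) (encode t)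
  (execute p (encode t)) (execute-pair t C D p)
execute-compile t (¬ₜ C) p = execute-prefix (false ∷ true ∷ false ∷ [])
  (encode (fill t C)) (compile C ++ p) (encode t) (execute p (encode t)) (execute-compile t C p)
execute-compile t 0ₜ p = execute-emits (encode 0ₜ) p (encode t)
execute-compile t 1ₜ p = execute-emits (encode 1ₜ) p (encode t)

execute-pair t C D p = ≡.trans (≡.cong (λ q → execute q (encode t)) (List.++-assoc (compile C) (compile D) p))
  (≡.trans (execute-compile t C (compile D ++ p))
    (≡.trans (≡.cong (append (encode (fill t C))) (execute-compile t D p))
      (append-++ (encode (fill t C)) (encode (fill t D)) (execute p (encode t)))))

execute-invalid : ∀ {p s} → copy ∈ p → transduce start 1 s ≡ nothing → execute p s ≡ nothing
execute-invalid              (here refl) e rewrite e = refl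
execute-invalid {emit _ ∷ _} (there c∈)  e = ≡.cong (Maybe.map _) (execute-invalid c∈ e)
execute-invalid {copy ∷ _}   (there _)   e rewrite e = refl

-- Only a copy inspects the input: the program of a context without a hole would output the code of
-- a term on every string.
data HasHole {n} : Context n → Set where
  hole : ∀ {x} → HasHole (var (inj₁ x))
  ∧ˡ   : ∀ {C D} → HasHole C → HasHole (C ∧ₜ D)
  ∧ʳ   : ∀ {C D} → HasHole D → HasHole (C ∧ₜ D)
  ∨ˡ   : ∀ {C D} → HasHole C → HasHole (C ∨ₜ D)
  ∨ʳ   : ∀ {C D} → HasHole D → HasHole (C ∨ₜ D)

copy∈compile : ∀ {n} {C : Context n} → HasHole C → copy ∈ compile C
copy∈compile hole               = here refl
copy∈compile (∧ˡ h)             = there (there (there (∈-++⁺ˡ (copy∈compile h))))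
copy∈compile (∧ʳ {C = C} h)     = there (there (there (∈-++⁺ʳ (compile C) (copy∈compile h))))
copy∈compile (∨ˡ h)             = there (there (there (∈-++⁺ˡ (copy∈compile h))))
copy∈compile (∨ʳ {C = C} h)     = there (there (there (∈-++⁺ʳ (compile C) (copy∈compile h))))

reduce : ∀ {n} → Context n → List Bool → List Bool
reduce C = maybe′ id [] ∘ execute (compile C)

reduce-encode : ∀ {n} (C : Context n) t → reduce C (encode t) ≡ encode (fill t C)
reduce-encode C t = ≡.cong (maybe′ id []) (≡.trans
  (≡.cong (λ p → execute p (encode t)) (≡.sym (List.++-identityʳ (compile C))))
  (≡.trans (execute-compile t C []) (≡.cong just (List.++-identityʳ _))))

code? : ∀ s → (∃[ t ] encode t ≡ s) ⊎ transduce start 1 s ≡ nothing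
code? s with transduce start 1 s in e
... | nothing = inj₂ refl
... | just _ with transduce-sound 1 s (λ e′ → just≢nothing (≡.trans (≡.sym e) e′))
  where
  just≢nothing : ∀ {o : List Bool} → ¬ just o ≡ nothing
  just≢nothing ()
... | t ∷ [] , s≡ = inj₁ (t , ≡.sym (≡.trans s≡ (List.++-identityʳ (encode t))))

Coded : ∀ {a} → Pred (Term ℕ) a → Pred (List Bool) a
Coded A s = ∃[ t ] encode t ≡ s × A t

-- If the output is a code, so is the input, because otherwise a copy jams and the output is empty;
-- injectivity of `encode` then identifies the output term as the filled context.
coded-reduction : ∀ {a b n} {A : Pred (Term ℕ) a} {B : Pred (Term ℕ) b} (C : Context n) → HasHole C →
  (∀ t → A t ⇔ B (fill t C)) → Coded A ≼ Coded B
coded-reduction {A = A} {B} C hasHole A⇔B =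
  reduce C , program-polynomialTime (compile C) , λ s → mk⇔ to (from s)
  where
  to : ∀ {s} → Coded A s → Coded B (reduce C s)
  to (t , refl , a) = fill t C , ≡.sym (reduce-encode C t) , Equivalence.to (A⇔B t) a

  from : ∀ s → Coded B (reduce C s) → Coded A s
  from s (u , e , b) with code? s
  ... | inj₁ (t , refl) = t , refl , Equivalence.from (A⇔B t)
          (≡.subst B (encode-injective (≡.trans e (reduce-encode C t))) b)
  ... | inj₂ invalid = ⊥-elim (encode-nonempty u
          (≡.trans e (≡.cong (maybe′ id []) (execute-invalid (copy∈compile hasHole) invalid))))

weakContext strongContext : ∀ d → Context (suc d)
weakContext d   = h-tilde (var (inj₁ tt)) (var ∘ inj₂)
strongContext d = g-tilde (var (inj₁ tt)) (var ∘ inj₂)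

-- Equivalences and reductions

module _ (em : ∀ {ℓ} → ExcludedMiddle ℓ) {c ℓ₁ ℓ₂} (L : ModularOrtholattice c ℓ₁ ℓ₂) where
  open ModularOrtholattice L using (Carrier; _≈_; _≤_; 0#; 1#; antisym; minimum; maximum; reflexive; module Eq; rawOrtholattice)
  open OrtholatticeProperties L

  module _ {d top} (series : CompositionSeries d top) (1≤top : 1# ≤ top) (1≰0 : ¬ 1# ≤ 0#)
    {a : Fin (suc d) → Carrier} (diamond : IsOrthogonalDiamond L d a) where

    private
      R = rawOrtholattice

      ≤0 : ∀ {x y} → x ≡ y → ¬ y ≈ 0# → ¬ x ≤ 0#
      ≤0 refl y≉0 x≤0 = y≉0 (antisym x≤0 (minimum _))

      ≈0 : ∀ {x y} → x ≡ y → ¬ y ≤ 0# → ¬ x ≈ 0#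
      ≈0 refl y≰0 x≈0 = y≰0 (reflexive x≈0)

      1≤ : ∀ {x y} → x ≡ y → y ≈ 1# → 1# ≤ x
      1≤ refl y≈1 = reflexive (Eq.sym y≈1)

      ≈1 : ∀ {x y} → x ≡ y → 1# ≤ y → x ≈ 1#
      ≈1 refl 1≤y = antisym (maximum _) 1≤y

    module _ {v} {V : Set v} (t : Term V) where
      private
        x : Term (V ⊎ Fin (suc d))
        x = rename inj₁ t

        y : Fin (suc d) → Term (V ⊎ Fin (suc d))
        y = var ∘ inj₂

      weak⇔strong-h-tilde : WeaklySatisfiable R t ⇔ StronglySatisfiable R (h-tilde x y)
      weak⇔strong-h-tilde = mk⇔
        (λ (ρ , t≉0) → let ρ′ = [ ρ , a ]′ in ρ′
          , ≈1 refl (nonzero⇒h-tilde ρ′ y 1≰0 diamond em series 1≤top x (≤0 (eval-rename R ρ′ inj₁ t) t≉0)))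
        (λ (ρ , h≈1) → ρ ∘ inj₁
          , ≈0 (≡.sym (eval-rename R ρ inj₁ t)) (h-tilde⇒nonzero ρ y 1≰0 x (1≤ refl h≈1)))

      strong⇔weak-g-tilde : StronglySatisfiable R t ⇔ WeaklySatisfiable R (g-tilde x y)
      strong⇔weak-g-tilde = mk⇔
        (λ (ρ , t≈1) → let ρ′ = [ ρ , a ]′ in ρ′
          , ≈0 refl (one⇒g-tilde ρ′ y 1≰0 diamond x (1≤ (eval-rename R ρ′ inj₁ t) t≈1)))
        (λ (ρ , g≉0) → ρ ∘ inj₁
          , ≈1 (≡.sym (eval-rename R ρ inj₁ t)) (g-tilde⇒one ρ y em series 1≤top x (≤0 refl g≉0)))

    module _ (t : Term ℕ) where
      private
        values : (ℕ → Carrier) → ⊤ ⊎ Fin (suc d) → Carrier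
        values ρ = [ const (eval R ρ t) , a ]′

        eval-fill : ∀ ρ (C : Context (suc d)) →
          eval R ([ ρ , a ]′ ∘ slot) (fill t C) ≡ eval R (values ρ) C
        eval-fill ρ C = ≡.trans (eval-substitute R ([ ρ , a ]′ ∘ slot) _ C) (eval-cong R agree C)
          where
          agree : ∀ z → eval R ([ ρ , a ]′ ∘ slot) ([ const (rename odd t) , var ∘ even ]′ z) ≡ values ρ z
          agree (inj₁ _) = ≡.trans (eval-rename R ([ ρ , a ]′ ∘ slot) odd t)
            (eval-cong R (λ k → ≡.cong [ ρ , a ]′ (slot-odd k)) t)
          agree (inj₂ i) = ≡.cong [ ρ , a ]′ (slot-even i)

        plugged : (ℕ → Carrier) → ⊤ ⊎ Fin (suc d) → Carrier
        plugged ρ = eval R ρ ∘ [ const (rename odd t) , var ∘ even ]′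

      -- The decision problems fix ℕ as the set of variables, so t and ȳ have to share it.
      -- Evaluating the context with the value of t in its hole reduces this to the case in which x
      -- is a single variable.
      weak⇔strong-fill : WeaklySatisfiable R t ⇔ StronglySatisfiable R (fill t (weakContext d))
      weak⇔strong-fill = mk⇔
        (λ (ρ , t≉0) → [ ρ , a ]′ ∘ slot
          , ≈1 (eval-fill ρ (weakContext d))
               (nonzero⇒h-tilde (values ρ) (var ∘ inj₂) 1≰0 diamond em series 1≤top (var (inj₁ tt)) (≤0 refl t≉0)))
        (λ (ρ , h≈1) → ρ ∘ odd
          , ≈0 (≡.sym (eval-rename R ρ odd t)) (h-tilde⇒nonzero (plugged ρ) (var ∘ inj₂) 1≰0 (var (inj₁ tt))
              (1≤ (≡.sym (eval-substitute R ρ _ (weakContext d))) h≈1)))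

      strong⇔weak-fill : StronglySatisfiable R t ⇔ WeaklySatisfiable R (fill t (strongContext d))
      strong⇔weak-fill = mk⇔
        (λ (ρ , t≈1) → [ ρ , a ]′ ∘ slot
          , ≈0 (eval-fill ρ (strongContext d))
               (one⇒g-tilde (values ρ) (var ∘ inj₂) 1≰0 diamond (var (inj₁ tt)) (1≤ refl t≈1)))
        (λ (ρ , g≉0) → ρ ∘ odd
          , ≈1 (≡.sym (eval-rename R ρ odd t)) (g-tilde⇒one (plugged ρ) (var ∘ inj₂) em series 1≤top (var (inj₁ tt))
              (≤0 (≡.sym (eval-substitute R ρ _ (strongContext d))) g≉0)))

-- In dimension 0 the joins in ĥ and the meet in g̃ are empty and no hole is left, whence `suc d`.
weakContext-hasHole : ∀ d → HasHole (weakContext (suc d))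
weakContext-hasHole d = ∧ʳ (∨ˡ (∨ˡ (∧ˡ (∨ˡ (∧ˡ (∨ˡ hole))))))

strongContext-hasHole : ∀ d → HasHole (strongContext (suc d))
strongContext-hasHole d = ∧ʳ (∧ˡ (∨ʳ (∧ˡ hole)))

satisfiability-reductions : (∀ {ℓ} → ExcludedMiddle ℓ) → ∀ {c ℓ₁ ℓ₂} (L : ModularOrtholattice c ℓ₁ ℓ₂) →
  let open ModularOrtholattice L; open OrtholatticeProperties L in
  ∀ {d top} → CompositionSeries (suc d) top → 1# ≤ top → ¬ 1# ≤ 0# →
  ∀ {a} → IsOrthogonalDiamond L (suc d) a →
  (sat rawOrtholattice ≼ SAT rawOrtholattice) × (SAT rawOrtholattice ≼ sat rawOrtholattice)
satisfiability-reductions em L {d} series 1≤top 1≰0 diamond =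
    coded-reduction {A = WeaklySatisfiable R} {B = StronglySatisfiable R}
      (weakContext (suc d)) (weakContext-hasHole d) (weak⇔strong-fill em L series 1≤top 1≰0 diamond)
  , coded-reduction {A = StronglySatisfiable R} {B = WeaklySatisfiable R}
      (strongContext (suc d)) (strongContext-hasHole d) (strong⇔weak-fill em L series 1≤top 1≰0 diamond)
  where R = ModularOrtholattice.rawOrtholattice L

subspace-reductions : (∀ {ℓ} → ExcludedMiddle ℓ) → ∀ {f m ℓm} (F : StarSubfield f) (H : UnitarySpace F m ℓm) →
  FiniteDimensional H → NonTrivial H →
  let R = subspaceOrtholattice H in (sat R ≼ SAT R) × (SAT R ≼ sat R)
subspace-reductions em F H finite (x , x≉0) with Unitary.orthogonalFrame em H finite
-- Without axes every vector is trivially orthogonal to all of them, so completeness makes the space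
-- zero.
... | zero  , φ , complete = ⊥-elim (x≉0 (complete λ ()))
... | suc d , φ , complete =
  satisfiability-reductions em (subspaces φ complete) (flag-series φ complete) (λ {x} _ → flag-top φ complete {x})
    (λ p → x≉0 (lower (p {x} _))) (isDiamond φ complete)
  where open Unitary em H

theorem5p1 : (∀ {ℓ} → ExcludedMiddle ℓ) → ∀ {c ℓ₁ ℓ₂ f m ℓm v : Level} →
    ((d : ℕ) → .{{_ : NonZero d}} → (L : ModularOrtholattice c ℓ₁ ℓ₂) →
      HasHeight L d → AdmitsOrthogonalDiamond L d →
      (V : Set v) (t : Term V) →
      let R = ModularOrtholattice.rawOrtholattice L
          x = rename (inj₁ {B = Fin (suc d)}) t
          y = λ (i : Fin (suc d)) → var (inj₂ {A = V} i)
      in (WeaklySatisfiable R t ⇔ StronglySatisfiable R (h-tilde x y))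
       × (StronglySatisfiable R t ⇔ WeaklySatisfiable R (g-tilde x y)))
    ×
    ((F : StarSubfield f) (H : UnitarySpace F m ℓm) →
      FiniteDimensional H → NonTrivial H →
      let R = subspaceOrtholattice H
      in (sat R ≼ SAT R) × (SAT R ≼ sat R))
theorem5p1 em = lattices , subspace-reductions em
  where
  lattices : (d : ℕ) → .{{_ : NonZero d}} → (L : ModularOrtholattice _ _ _) →
    HasHeight L d → AdmitsOrthogonalDiamond L d → (V : Set _) (t : Term V) → _
  lattices d L height@(_ , isMax) (_ , diamond) V t =
      weak⇔strong-h-tilde em L series top-one 1≰0 diamond t
    , strong⇔weak-g-tilde em L series top-one 1≰0 diamond t
    where
    open OrtholatticeProperties L
    open MaximalChain isMax
    1≰0 = height-nontrivial height
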